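{- Let $\{\mathcal G_i : i\in I\}$ be a family of ultrafilters on $\mathbb N$, let $\mathcal H$ be an ultrafilter on $I$, and let $\mathcal F=\lim_{i\to\mathcal H}\mathcal G_i$. Then for every basic class $\mathcal P^u\in\mathcal B$, $$\alpha_{\mathcal F}(\mathcal P^u)=\min_{A\in\mathcal P^u\cap\mathcal C}\ \mathcal H\text{ - }\lim_{i}\ \sum_{\mathcal Q^v\in\overline{A}}\alpha_{\mathcal G_i}(\mathcal Q^v).$$
   Context: Divisibility of ultrafilters. $\mathbb N=\{1,2,3,\dots\}$, $\mathbb P$ is the set of primes, $\beta\mathbb N$ is the set of ultrafilters on $\mathbb N$, with $n\in\mathbb N$ identified with the principal ultrafilter at $n$. For $A\subseteq\mathbb N$ let $A\uparrow=\{n\in\mathbb N:(\exists a\in A)\,a\mid n\}$, and $\mathcal U=\{A\subseteq\mathbb N: A\ne\emptyset,\ A=A\uparrow\}$. For $\mathcal F,\mathcal G\in\beta\mathbb N$: $\mathcal F\,\widetilde{\mid}\,\mathcal G$ iff $\mathcal F\cap\mathcal U\subseteq\mathcal G$; $\mathcal F=_\sim\mathcal G$ iff $\mathcal F\,\widetilde{\mid}\,\mathcal G$ and $\mathcal G\,\widetilde{\mid}\,\mathcal F$. Nonstandard extension. Standing assumption: we work in a fixed nonstandard extension ${}^*$ (of a superstructure over $\mathbb N$) which is $\mathfrak c^+$-saturated and satisfies Henson's isomorphism property (any two elementarily equivalent internally presented structures, for a finite first-order language, are isomorphic). In particular all sets $[1,z]=\{a\in{}^*\mathbb N:a\le z\}$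 with $z\in{}^*\mathbb N\setminus\mathbb N$ have the same cardinality, denoted $\infty$. For $x\in{}^*\mathbb N$, $tp(x/\mathbb N)=\{A\subseteq\mathbb N:x\in{}^*A\}\in\beta\mathbb N$; $x\models\mathcal F$ ($x$ is a generator of $\mathcal F$) means $tp(x/\mathbb N)=\mathcal F$. ${}^*\!\mid$ is the extension of divisibility to ${}^*\mathbb N$. Basic classes. $\overline{\mathbb P}=\{\mathcal P\in\beta\mathbb N:\mathbb P\in\mathcal P\}$. For $\mathcal P\in\overline{\mathbb P}$, on pairs $(p,a)$ with $p\models\mathcal P$, $a\in{}^*\mathbb N$, put $(p,a)\approx_{\mathcal P}(q,b)$ iff $tp(p^a/\mathbb N)=_\sim tp(q^b/\mathbb N)$; $\mathcal E_{\mathcal P}$ is the set of $\approx_{\mathcal P}$-classes. For $u\in\mathcal E_{\mathcal P}$ the set $\mathcal P^u=\{tp(p^a/\mathbb N):(p,a)\in u\}$ is called a basic class, and $\mathcal B$ is the set of all basic classes. $p^a\models\mathcal P^u$ means $(p,a)\in u$. For $A\subseteq\mathbb N$, $A\in\mathcal P^u$ means $A\in\mathcal F$ for all $\mathcal F\in\mathcal P^u$. For a standard prime $p$ the basic classes are $p^k$ ($k\in\mathbb N$) and a single further one, $p^\omega$ (generated by $p^a$ with $a$ infinite). Patterns. $\mathbb N_\infty=\{0,1,2,\dots\}\cup\{\infty\}$ with its natural order and the topology of the one-point compactification of the discrete space $\{0,1,2,\dots\}$. For $x\in{}^*\mathbb N$, $p\in{}^*\mathbb P$, $a\in{}^*\mathbb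 N$, $p^a\,{}^*\!\!\parallel x$ ($p^a$ is an exact divisor of $x$) means $x=p^ax'$ with $p$ not dividing $x'$. The pattern of $x$ is $\alpha_x:\mathcal B\to\mathbb N_\infty$, $\alpha_x(\mathcal P^u)=|\{(p,a):p^a\models\mathcal P^u,\ p^a\,{}^*\!\!\parallel x\}|$ (this cardinality is known to lie in $\mathbb N_\infty$). For $\mathcal F\in\beta\mathbb N$, $\alpha_{\mathcal F}:=\alpha_x$ for any $x\models\mathcal F$ (known to be independent of $x$). Convex sets. $\mathbb P^{exp}=\{p^n:p\in\mathbb P,n\in\mathbb N\}$. $A\subseteq\mathbb N$ is convex if $a,b\in A$, $a\mid c$, $c\mid b$ imply $c\in A$. $\mathcal C$ is the family of nonempty convex subsets of $\mathbb P^{exp}$; $\mathcal P^u\cap\mathcal C=\{A\in\mathcal C:A\in\mathcal P^u\}$. For $A\in\mathcal C$, $\overline A=\{\mathcal Q^v\in\mathcal B:A\in\mathcal Q^v\}$. Sums are sums of cardinals; for patterns of ultrafilters the sums $\sum_{\mathcal Q^v\in\overline A}\alpha_{\mathcal G}(\mathcal Q^v)$, $A\in\mathcal C$, lie in $\mathbb N_\infty$. Limits. $\lim_{i\to\mathcal H}\mathcal G_i$ is the ultrafilter with $A\in\lim_{i\to\mathcal H}\mathcal G_i$ iff $\{i\in I:A\in\mathcal G_i\}\in\mathcal H$. For $x_i,y\in\mathbb N_\infty$, $\mathcal H\text{ - }\lim x_i=y$ means that $\{i\in I:x_i\in D\}\in\mathcal H$ for every neighborhood $D$ of $y$. -}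

module Defs where

open import Level using (Level; 0ℓ; _⊔_) renaming (suc to lsuc)
open import Data.Bool.Base using (Bool; if_then_else_)
open import Data.Empty using (⊥)
open import Data.Fin.Base using (Fin)
open import Data.List.Base using (List)
import Data.List.Membership.Propositional as List
open import Data.List.Relation.Unary.All using (All)
open import Data.Nat.Base as ℕ using (ℕ; zero; suc; NonZero)
import Data.Nat.Divisibility as ℕ
import Data.Nat.Primality as ℕ
open import Data.Product using (Σ; ∃; ∃₂; ∃-syntax; _×_; _,_; proj₁; proj₂)
open import Data.Product.Relation.Binary.Pointwise.NonDependent using (×-setoid)
open import Data.Sum.Base using (_⊎_; inj₁; inj₂)
open import Data.Unit.Base using (⊤; tt)
open import Data.Vec.Functional as Vec using (Vector; _∷_)
open import Function.Base using (_∘_)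
open import Function.Bundles using (_⇔_; Bijection)
open import Relation.Binary using (Rel; Setoid; IsEquivalence)
import Relation.Binary.Construct.On as On
open import Relation.Binary.Construct.Add.Supremum.NonStrict ℕ._≤_ public using (_≤⁺_)
open import Relation.Binary.PropositionalEquality using (_≡_; refl; setoid)
import Relation.Binary.PropositionalEquality as ≡
open import Relation.Nullary using (¬_)
open import Relation.Nullary.Construct.Add.Supremum using (_⁺; ⊤⁺; [_])
open import Relation.Unary
  using (Pred; _∈_; _∉_; _⊆_; _∩_; ∁; ∅; U; _≐_; Satisfiable)

record ℕ⁺ : Set where
  constructor pos
  field
    value          : ℕ
    .{{value≢0}}   : NonZero value

open ℕ⁺ public

_∣⁺_ : Rel ℕ⁺ 0ℓ
m ∣⁺ n = value m ℕ.∣ value n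

Prime⁺ : Pred ℕ⁺ 0ℓ
Prime⁺ p = ℕ.Prime (value p)

record Ultrafilter {a} (X : Set a) : Set (a ⊔ lsuc 0ℓ) where
  field
    member : Pred (Pred X 0ℓ) 0ℓ
    full   : U ∈ member
    proper : ∅ ∉ member
    meet   : ∀ {A B} → A ∈ member → B ∈ member → (A ∩ B) ∈ member
    upward : ∀ {A B} → A ⊆ B → A ∈ member → B ∈ member
    ultra  : ∀ A → A ∈ member ⊎ ∁ A ∈ member

open Ultrafilter public using (member)

lim : ∀ {i a} {I : Set i} {X : Set a} →
      Ultrafilter I → (I → Ultrafilter X) → Ultrafilter X
lim H G = record
  { member = λ A → (λ i → A ∈ member (G i)) ∈ member H
  ; full   = H.upward (λ {i} _ → G.full i) H.full
  ; proper = λ h → H.proper (H.upward (λ {i} → G.proper i) h)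
  ; meet   = λ h k → H.upward (λ {i} (p , q) → G.meet i p q) (H.meet h k)
  ; upward = λ A⊆B → H.upward (λ {i} → G.upward i A⊆B)
  ; ultra  = λ A → ultra′ A (H.ultra (λ i → A ∈ member (G i)))
  }
  where
  module H = Ultrafilter H
  module G i = Ultrafilter (G i)
  resolve : ∀ {A i} → A ∉ member (G i) → A ∈ member (G i) ⊎ ∁ A ∈ member (G i) →
            ∁ A ∈ member (G i)
  resolve A∉ (inj₁ A∈)  with () ← A∉ A∈
  resolve A∉ (inj₂ ∁A∈) = ∁A∈
  ultra′ : ∀ A →
           (λ i → A ∈ member (G i)) ∈ member H ⊎ (λ i → A ∉ member (G i)) ∈ member H →
           (λ i → A ∈ member (G i)) ∈ member H ⊎ (λ i → ∁ A ∈ member (G i)) ∈ member H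
  ultra′ A (inj₁ h) = inj₁ h
  ultra′ A (inj₂ h) = inj₂ (H.upward (λ {i} A∉ → resolve A∉ (G.ultra i A)) h)

infix 9 _↑

_↑ : Pred ℕ⁺ 0ℓ → Pred ℕ⁺ 0ℓ
(A ↑) n = ∃[ a ] (a ∈ A × a ∣⁺ n)

𝓤 : Pred (Pred ℕ⁺ 0ℓ) 0ℓ
𝓤 A = Satisfiable A × A ≐ A ↑

-- Divisibility and =∼ are stated for arbitrary families of sets, so that they
-- apply to types of elements without first packaging these as ultrafilters.
_∣~_ _=~_ : Rel (Pred (Pred ℕ⁺ 0ℓ) 0ℓ) (lsuc 0ℓ)
𝓕 ∣~ 𝓖 = 𝓕 ∩ 𝓤 ⊆ 𝓖
𝓕 =~ 𝓖 = 𝓕 ∣~ 𝓖 × 𝓖 ∣~ 𝓕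

Convex : Pred (Pred ℕ⁺ 0ℓ) 0ℓ
Convex A = ∀ {a b c} → a ∈ A → b ∈ A → a ∣⁺ c → c ∣⁺ b → c ∈ A

PowerOf : ℕ⁺ → ℕ⁺ → ℕ⁺ → Set
PowerOf p n q = value p ℕ.^ value n ≡ value q

ℙᵉˣᵖ : Pred ℕ⁺ 0ℓ
ℙᵉˣᵖ q = ∃₂ λ p n → p ∈ Prime⁺ × PowerOf p n q

𝓒 : Pred (Pred ℕ⁺ 0ℓ) 0ℓ
𝓒 A = Satisfiable A × A ⊆ ℙᵉˣᵖ × Convex A

ℕ∞ : Set
ℕ∞ = ℕ ⁺

pattern ∞ = ⊤⁺

-- The one-point compactification of discrete ℕ: an open set containing ∞ has
-- compact, that is finite, complement in ℕ.
Open : Pred (Pred ℕ∞ 0ℓ) 0ℓ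
Open O = ∞ ∈ O → ∃[ ns ] (∀ n → [ n ] ∉ O → n List.∈ ns)

Neighbourhood : ℕ∞ → Pred (Pred ℕ∞ 0ℓ) (lsuc 0ℓ)
Neighbourhood y D = ∃[ O ] (O ∈ Open × y ∈ O × O ⊆ D)

HLim : ∀ {i} {I : Set i} → Ultrafilter I → (I → ℕ∞) → ℕ∞ → Set (lsuc 0ℓ)
HLim H x y = ∀ D → D ∈ Neighbourhood y → (λ i → x i ∈ D) ∈ member H

IsMinimum : {X : Set₁} → Pred X (lsuc 0ℓ) → (X → ℕ∞) → ℕ∞ → Set₁
IsMinimum P f m = (∃[ x ] (x ∈ P × f x ≡ m)) × (∀ x → x ∈ P → m ≤⁺ f x)

-- V X contains the well-founded sets over the atoms X; the superstructure
-- over X consists of its elements of finite rank.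

data V (X : Set) : Set₁ where
  atom : X → V X
  set  : (J : Set) → (J → V X) → V X

module _ {X : Set} where

  infix 4 _≈ⱽ_ _∈ⱽ_

  Ix : V X → Set
  Ix (atom _)  = ⊥
  Ix (set J _) = J

  at : (v : V X) → Ix v → V X
  at (set _ f) = f

  _≈ⱽ_ : V X → V X → Set
  atom x  ≈ⱽ atom y  = x ≡ y
  atom _  ≈ⱽ set _ _ = ⊥
  set _ _ ≈ⱽ atom _  = ⊥
  set J f ≈ⱽ set K g =
    (∀ j → ∃[ k ] f j ≈ⱽ g k) × (∀ k → ∃[ j ] f j ≈ⱽ g k)

  _∈ⱽ_ : V X → V X → Set
  v ∈ⱽ w = ∃[ j ] v ≈ⱽ at w j

  ≈ⱽ-refl : ∀ v → v ≈ⱽ v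
  ≈ⱽ-refl (atom _)  = refl
  ≈ⱽ-refl (set _ f) = (λ j → j , ≈ⱽ-refl (f j)) , (λ j → j , ≈ⱽ-refl (f j))

  ≈ⱽ-sym : ∀ v w → v ≈ⱽ w → w ≈ⱽ v
  ≈ⱽ-sym (atom _)  (atom _)  e       = ≡.sym e
  ≈ⱽ-sym (set _ f) (set _ g) (l , r) =
    (λ k → proj₁ (r k) , ≈ⱽ-sym (f _) (g k) (proj₂ (r k))) ,
    (λ j → proj₁ (l j) , ≈ⱽ-sym (f j) (g _) (proj₂ (l j)))

  ≈ⱽ-trans : ∀ u v w → u ≈ⱽ v → v ≈ⱽ w → u ≈ⱽ w
  ≈ⱽ-trans (atom _)  (atom _)  (atom _)  d       e         = ≡.trans d e
  ≈ⱽ-trans (set _ f) (set _ g) (set _ h) (l , r) (l′ , r′) =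
    (λ i → let (j , d) = l i ; (k , e) = l′ j in k , ≈ⱽ-trans (f i) (g j) (h k) d e) ,
    (λ k → let (j , e) = r′ k ; (i , d) = r j in i , ≈ⱽ-trans (f i) (g j) (h k) d e)

  V-setoid : Setoid (lsuc 0ℓ) 0ℓ
  V-setoid = record
    { Carrier       = V X
    ; _≈_           = _≈ⱽ_
    ; isEquivalence = record
      { refl  = λ {v} → ≈ⱽ-refl v
      ; sym   = λ {v} {w} → ≈ⱽ-sym v w
      ; trans = λ {u} {v} {w} → ≈ⱽ-trans u v w
      }
    }

  Rank≤ : ℕ → V X → Set
  Rank≤ _       (atom _)  = ⊤
  Rank≤ zero    (set _ _) = ⊥
  Rank≤ (suc n) (set _ f) = ∀ j → Rank≤ n (f j)

  FiniteRank : V X → Set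
  FiniteRank v = ∃[ n ] Rank≤ n v

  ∅ⱽ : V X
  ∅ⱽ = set ⊥ (λ ())

  ⟅_,_⟆ : V X → V X → V X
  ⟅ v , w ⟆ = set Bool (λ b → if b then v else w)

  -- Kuratowski pairs
  ⟨_,_⟩ : V X → V X → V X
  ⟨ v , w ⟩ = ⟅ ⟅ v , v ⟆ , ⟅ v , w ⟆ ⟆

  tuple : ∀ {n} → Vector (V X) n → V X
  tuple = Vec.foldr ⟨_,_⟩ ∅ⱽ

  ⌜_⌝ : Pred X 0ℓ → V X
  ⌜ A ⌝ = set (∃ A) (atom ∘ proj₁)

  ⌜_⌝₂ : (X → X → Set) → V X
  ⌜ R ⌝₂ = set (∃₂ R) λ (x , y , _) → ⟨ atom x , atom y ⟩

  ⌜_⌝₃ : (X → X → X → Set) → V X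
  ⌜ R ⌝₃ = set (∃[ x ] ∃[ y ] ∃[ z ] R x y z)
               λ (x , y , z , _) → ⟨ atom x , ⟨ atom y , atom z ⟩ ⟩

-- First-order formulas in ∈ and = with bounded quantifiers
-- (de Bruijn indices; the bound of a quantifier is a variable in scope).
data BoundedFormula (n : ℕ) : Set where
  _`∈_ _`=_        : Fin n → Fin n → BoundedFormula n
  `¬_              : BoundedFormula n → BoundedFormula n
  _`∧_ _`∨_ _`⇒_   : BoundedFormula n → BoundedFormula n → BoundedFormula n
  `∀∈ `∃∈          : Fin n → BoundedFormula (suc n) → BoundedFormula n

⟦_⟧ᵇ : ∀ {n X} → BoundedFormula n → Vector (V X) n → Set
⟦ x `∈ y ⟧ᵇ ρ  = ρ x ∈ⱽ ρ y
⟦ x `= y ⟧ᵇ ρ  = ρ x ≈ⱽ ρ y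
⟦ `¬ φ ⟧ᵇ ρ    = ¬ ⟦ φ ⟧ᵇ ρ
⟦ φ `∧ ψ ⟧ᵇ ρ  = ⟦ φ ⟧ᵇ ρ × ⟦ ψ ⟧ᵇ ρ
⟦ φ `∨ ψ ⟧ᵇ ρ  = ⟦ φ ⟧ᵇ ρ ⊎ ⟦ ψ ⟧ᵇ ρ
⟦ φ `⇒ ψ ⟧ᵇ ρ  = ⟦ φ ⟧ᵇ ρ → ⟦ ψ ⟧ᵇ ρ
⟦ `∀∈ y φ ⟧ᵇ ρ = ∀ j → ⟦ φ ⟧ᵇ (at (ρ y) j ∷ ρ)
⟦ `∃∈ y φ ⟧ᵇ ρ = ∃[ j ] ⟦ φ ⟧ᵇ (at (ρ y) j ∷ ρ)

-- ⋆_ is meaningful only on the superstructure; its values at elements of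
-- infinite rank are irrelevant and unconstrained.
record NonstandardExtension : Set₁ where
  field
    ⋆ℕ              : Set
    ι               : ℕ⁺ → ⋆ℕ
    ⋆_              : V ℕ⁺ → V ⋆ℕ
    ⋆-superstructure : ∀ v → FiniteRank v → FiniteRank (⋆ v)
    ⋆-atom          : ∀ n → ⋆ (atom n) ≈ⱽ atom (ι n)
    ⋆-base          : ⋆ ⌜ U ⌝ ≈ⱽ ⌜ U ⌝
    transfer        : ∀ {n} (φ : BoundedFormula n) (ρ : Vector (V ℕ⁺) n) →
                      (∀ k → FiniteRank (ρ k)) →
                      ⟦ φ ⟧ᵇ ρ ⇔ ⟦ φ ⟧ᵇ (λ k → ⋆ ρ k)

record Language : Set where
  field
    relations functions : ℕ
    relArity            : Fin relations → ℕ
    funArity            : Fin functions → ℕ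

module _ (L : Language) where
  open Language L

  data Term (n : ℕ) : Set where
    var : Fin n → Term n
    app : (f : Fin functions) → Vector (Term n) (funArity f) → Term n

  data Formula (n : ℕ) : Set where
    rel            : (r : Fin relations) → Vector (Term n) (relArity r) → Formula n
    _`=_           : Term n → Term n → Formula n
    `¬_            : Formula n → Formula n
    _`∧_ _`∨_ _`⇒_ : Formula n → Formula n → Formula n
    `∀ `∃          : Formula (suc n) → Formula n

module Extension (E : NonstandardExtension) where
  open NonstandardExtension E

  Internal : V ⋆ℕ → Set₁
  Internal v = ∃[ w ] (FiniteRank w × v ∈ⱽ ⋆ w)

  -- Families indexed by ℕ → Bool are the families of cardinality at most 𝔠.
  𝔠⁺-Saturated : Set₁
  𝔠⁺-Saturated =
    (A : (ℕ → Bool) → V ⋆ℕ) → (∀ j → Internal (A j)) →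
    (∀ (js : List (ℕ → Bool)) → ∃[ v ] All (λ j → v ∈ⱽ A j) js) →
    ∃[ v ] (∀ j → v ∈ⱽ A j)

  -- The elements of the structure are the elements of the internal set dom.
  -- A relation is given by an internal set of tuples, a function by its values
  -- and an internal set of tuples (value , arguments) representing its graph.
  record InternalStructure (L : Language) : Set₁ where
    open Language L
    field
      dom           : V ⋆ℕ
      dom-internal  : Internal dom
      dom-nonempty  : Ix dom
      relSet        : Fin relations → V ⋆ℕ
      rel-internal  : ∀ r → Internal (relSet r)
      fun           : ∀ f → Vector (Ix dom) (funArity f) → Ix dom
      graph         : Fin functions → V ⋆ℕ
      graph-internal : ∀ f → Internal (graph f)
      graph-spec    : ∀ f xs y →
                      tuple (at dom y ∷ (at dom ∘ xs)) ∈ⱽ graph f ⇔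
                      at dom y ≈ⱽ at dom (fun f xs)

    domain : Setoid 0ℓ 0ℓ
    domain = On.setoid V-setoid (at dom)

    open Setoid domain public using (Carrier; _≈_)

    Holds : ∀ r → Vector Carrier (relArity r) → Set
    Holds r xs = tuple (at dom ∘ xs) ∈ⱽ relSet r

    ⟦_⟧ᵗ : ∀ {n} → Term L n → Vector Carrier n → Carrier
    ⟦ var x ⟧ᵗ ρ    = ρ x
    ⟦ app f ts ⟧ᵗ ρ = fun f (λ k → ⟦ ts k ⟧ᵗ ρ)

    ⟦_⟧ᶠ : ∀ {n} → Formula L n → Vector Carrier n → Set
    ⟦ rel r ts ⟧ᶠ ρ = Holds r (λ k → ⟦ ts k ⟧ᵗ ρ)
    ⟦ s `= t ⟧ᶠ ρ   = ⟦ s ⟧ᵗ ρ ≈ ⟦ t ⟧ᵗ ρ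
    ⟦ `¬ φ ⟧ᶠ ρ     = ¬ ⟦ φ ⟧ᶠ ρ
    ⟦ φ `∧ ψ ⟧ᶠ ρ   = ⟦ φ ⟧ᶠ ρ × ⟦ ψ ⟧ᶠ ρ
    ⟦ φ `∨ ψ ⟧ᶠ ρ   = ⟦ φ ⟧ᶠ ρ ⊎ ⟦ ψ ⟧ᶠ ρ
    ⟦ φ `⇒ ψ ⟧ᶠ ρ   = ⟦ φ ⟧ᶠ ρ → ⟦ ψ ⟧ᶠ ρ
    ⟦ `∀ φ ⟧ᶠ ρ     = ∀ x → ⟦ φ ⟧ᶠ (x ∷ ρ)
    ⟦ `∃ φ ⟧ᶠ ρ     = ∃[ x ] ⟦ φ ⟧ᶠ (x ∷ ρ)

  ElementarilyEquivalent : ∀ {L} → InternalStructure L → InternalStructure L → Set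
  ElementarilyEquivalent {L} 𝔄 𝔅 = ∀ (φ : Formula L 0) → 𝔄.⟦ φ ⟧ᶠ Vec.[] ⇔ 𝔅.⟦ φ ⟧ᶠ Vec.[]
    where module 𝔄 = InternalStructure 𝔄
          module 𝔅 = InternalStructure 𝔅

  record Isomorphism {L} (𝔄 𝔅 : InternalStructure L) : Set where
    private
      module 𝔄 = InternalStructure 𝔄
      module 𝔅 = InternalStructure 𝔅
    field
      bijection : Bijection 𝔄.domain 𝔅.domain
    open Bijection bijection using (to)
    field
      preserves-rel : ∀ r xs → 𝔄.Holds r xs ⇔ 𝔅.Holds r (to ∘ xs)
      preserves-fun : ∀ f xs → to (𝔄.fun f xs) 𝔅.≈ 𝔅.fun f (to ∘ xs)

  IsomorphismProperty : Set₁
  IsomorphismProperty = ∀ {L} (𝔄 𝔅 : InternalStructure L) →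
                        ElementarilyEquivalent 𝔄 𝔅 → Isomorphism 𝔄 𝔅

  infix 4 _∈⋆_

  _∈⋆_ : ⋆ℕ → Pred ℕ⁺ 0ℓ → Set
  x ∈⋆ A = atom x ∈ⱽ ⋆ ⌜ A ⌝

  _⋆≤_ _⋆∣_ : ⋆ℕ → ⋆ℕ → Set
  x ⋆≤ y = ⟨ atom x , atom y ⟩ ∈ⱽ ⋆ ⌜ (λ m n → value m ℕ.≤ value n) ⌝₂
  x ⋆∣ y = ⟨ atom x , atom y ⟩ ∈ⱽ ⋆ ⌜ _∣⁺_ ⌝₂

  IsPower : ⋆ℕ → ⋆ℕ → ⋆ℕ → Set   -- c = p ^ a
  IsPower p a c = ⟨ atom p , ⟨ atom a , atom c ⟩ ⟩ ∈ⱽ ⋆ ⌜ PowerOf ⌝₃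

  IsProduct : ⋆ℕ → ⋆ℕ → ⋆ℕ → Set   -- z = x * y
  IsProduct x y z =
    ⟨ atom x , ⟨ atom y , atom z ⟩ ⟩ ∈ⱽ
    ⋆ ⌜ (λ k m n → value k ℕ.* value m ≡ value n) ⌝₃

  Infinite : Pred ⋆ℕ 0ℓ
  Infinite x = ∀ n → ¬ (x ≡ ι n)

  tp : ⋆ℕ → Pred (Pred ℕ⁺ 0ℓ) 0ℓ
  tp x A = x ∈⋆ A

  -- tp (p ^ a), for the unique c with c = p ^ a
  tp^ : ⋆ℕ → ⋆ℕ → Pred (Pred ℕ⁺ 0ℓ) 0ℓ
  tp^ p a A = ∃[ c ] (IsPower p a c × A ∈ tp c)

  _⊨_ : ⋆ℕ → Ultrafilter ℕ⁺ → Set₁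
  x ⊨ F = tp x ≐ member F

  ExactlyDivides : ⋆ℕ → ⋆ℕ → ⋆ℕ → Set   -- p ^ a ∥ x
  ExactlyDivides p a x =
    ∃₂ λ c x′ → IsPower p a c × IsProduct c x′ x × ¬ (p ⋆∣ x′)

  -- A basic class 𝒫ᵘ is represented by a pair (p , a) ∈ u.  Pairs represent
  -- the same class iff their bases generate the same 𝒫 and they are
  -- equivalent under ≈_𝒫.

  record BasicClass : Set where
    field
      base       : ⋆ℕ
      exponent   : ⋆ℕ
      base-prime : base ∈⋆ Prime⁺

  open BasicClass

  _≈ᴮ_ : Rel BasicClass (lsuc 0ℓ)
  u ≈ᴮ v = tp (base u) ≐ tp (base v) ×
           tp^ (base u) (exponent u) =~ tp^ (base v) (exponent v)

  𝓑 : Setoid 0ℓ (lsuc 0ℓ)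
  𝓑 = record
    { Carrier       = BasicClass
    ; _≈_           = _≈ᴮ_
    ; isEquivalence = record
      { refl  = ((λ h → h) , (λ h → h)) , (proj₁ , proj₁)
      ; sym   = λ ((a , b) , (c , d)) → (b , a) , (d , c)
      ; trans = λ ((a , b) , (c , d)) ((a′ , b′) , (c′ , d′)) →
                ((a′ ∘ a) , (b ∘ b′)) ,
                ((λ (h , A∈𝓤) → c′ (c (h , A∈𝓤) , A∈𝓤)) ,
                 (λ (h , A∈𝓤) → d (d′ (h , A∈𝓤) , A∈𝓤)))
      }
    }

  -- A ∈ 𝒫ᵘ : the set A belongs to tp (q ^ b) for all (q , b) ∈ u.
  _∈ᴮ_ : Pred ℕ⁺ 0ℓ → BasicClass → Set₁
  A ∈ᴮ u = ∀ v → v ≈ᴮ u → A ∈ tp^ (base v) (exponent v)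

  -- The cardinal ∞ is that of [1,z] for a fixed infinite z; by the isomorphism
  -- property it does not depend on z.

  module Cardinality (z : ⋆ℕ) where

    -- A set of cardinality k: [1,n] for k = n, and [1,z] for k = ∞.
    Segment : ℕ∞ → Pred ⋆ℕ 0ℓ
    Segment [ n ] a = ∃[ m ] (value m ℕ.≤ n × a ≡ ι m)
    Segment ∞     a = a ⋆≤ z

    HasCard : ∀ {a ℓ} → Setoid a ℓ → ℕ∞ → Set (a ⊔ ℓ)
    HasCard S k = Bijection (On.setoid {B = ∃ (Segment k)} (setoid ⋆ℕ) proj₁) S

    ExactDivisor : ⋆ℕ → BasicClass → Pred BasicClass (lsuc 0ℓ)
    ExactDivisor x u v = v ≈ᴮ u × ExactlyDivides (base v) (exponent v) x

    -- Compared as pairs (p , a), not as basic classes.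
    exactDivisors : ⋆ℕ → BasicClass → Setoid (lsuc 0ℓ) 0ℓ
    exactDivisors x u =
      On.setoid {B = ∃ (ExactDivisor x u)} (setoid (⋆ℕ × ⋆ℕ))
                (λ (v , _) → base v , exponent v)

    IsPattern : ⋆ℕ → (BasicClass → ℕ∞) → Set₁
    IsPattern x α = ∀ u → HasCard (exactDivisors x u) (α u)

    -- α = α_x for some generator x of F; the choice of x is immaterial.
    IsPatternᵁ : Ultrafilter ℕ⁺ → (BasicClass → ℕ∞) → Set₁
    IsPatternᵁ F α = ∃[ x ] (x ⊨ F × IsPattern x α)

    -- The disjoint union, over the basic classes v in A̅, of sets of
    -- cardinality α v.
    disjointUnion : (BasicClass → ℕ∞) → Pred ℕ⁺ 0ℓ → Setoid (lsuc 0ℓ) (lsuc 0ℓ)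
    disjointUnion α A =
      On.setoid {B = ∃[ v ] (A ∈ᴮ v × ∃ (Segment (α v)))} (×-setoid 𝓑 (setoid ⋆ℕ))
                (λ (v , _ , a , _) → v , a)

    IsSum : (BasicClass → ℕ∞) → Pred ℕ⁺ 0ℓ → ℕ∞ → Set₁
    IsSum α A = HasCard (disjointUnion α A)

{-# OPTIONS --safe #-}

-- Say that x has n divisors in A if n different exact prime power divisors of
-- x lie in A.  Dividing them out one after the other makes this a first-order
-- property of x, defining a set Divisors≥ n A ⊆ ℕ⁺, so by transfer a generator x
-- of 𝒢 has n divisors in A iff Divisors≥ n A ∈ 𝒢.  For convex A the sum of α_𝒢
-- over A̅ counts the divisors of x in A, because membership of A is constant on
-- basic classes.  Hence the limit over ℋ of these sums is at least n iff a
-- generator x of ℱ has n divisors in A, and it is at least α_ℱ(𝒫ᵘ) for A ∈ 𝒫ᵘ.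
-- If α_ℱ(𝒫ᵘ) = n is finite and no limit equals n, divide the n exact divisors of
-- x in 𝒫ᵘ out of x.  What remains still has a divisor in each convex A ∈ 𝒫ᵘ, so
-- by saturation it has one lying in all of them; since a basic class is determined by
-- its convex members, this is an (n+1)-st exact divisor of x in 𝒫ᵘ.

module Submission where

open import Defs
open import Axiom.ExcludedMiddle using (ExcludedMiddle)
open import Data.Bool.Base using (Bool; true; false)
open import Data.Fin.Base using (Fin; zero; suc; _↑ˡ_; _↑ʳ_; splitAt; toℕ; fromℕ<; punchIn)
open import Data.Fin.Patterns using (0F; 1F; 2F; 3F; 4F; 5F; 6F; 7F; 8F)
open import Data.Fin.Properties using (toℕ-injective; toℕ<n; fromℕ<-injective; injective⇒≤; punchIn-injective; punchInᵢ≢i; suc-injective)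
open import Data.List.Base as List using (List)
open import Data.List.Membership.Propositional using () renaming (_∈_ to _∈ₗ_)
open import Data.List.Relation.Unary.All as All using (All)
open import Data.List.Relation.Unary.Any using (here; there)
open import Data.Nat.Base as ℕ using (ℕ; zero; suc; NonZero)
import Data.Nat.Divisibility as ℕ
import Data.Nat.Primality as ℕ
import Data.Nat.Properties as ℕ
open import Data.Nat.Tactic.RingSolver using (solve-∀)
open import Data.Product using (∃; ∃₂; ∃-syntax; Σ-syntax; _×_; _,_; proj₁; proj₂)
open import Data.Product.Function.NonDependent.Propositional using (_×-⇔_)
open import Data.Sum.Base using (_⊎_; inj₁; inj₂; [_,_]′)
open import Data.Sum.Function.Propositional using (_⊎-⇔_)
open import Data.Unit.Base using (tt)
open import Data.Vec.Functional using (Vector; _∷_; _++_; [])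
open import Data.Vec.Functional.Properties using (lookup-++ˡ; lookup-++ʳ)
open import Function.Base using (_∘_; id)
open import Function.Bundles using (_⇔_; mk⇔; Equivalence; Bijection)
open import Function.Construct.Identity using (⇔-id)
open import Function.Construct.Symmetry using (⇔-sym)
open import Function.Related.TypeIsomorphisms using (→-cong-⇔; ¬-cong-⇔)
open import Level using (0ℓ; _⊔_)
open import Relation.Binary using (Setoid)
open import Relation.Binary.Construct.Add.Supremum.NonStrict ℕ._≤_ using ([_]; _≤⊤⁺; ≤⁺-trans; ≤⁺-antisym-≡)
import Relation.Binary.Construct.On as On
open import Relation.Binary.PropositionalEquality using (_≡_; refl; sym; trans; cong; subst; cong₂; setoid)
open import Relation.Nullary using (¬_; yes; no; contradiction; Dec)
open import Relation.Nullary.Construct.Add.Supremum using ([_])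
open import Relation.Nullary.Decidable using (recompute; decidable-stable)
open import Relation.Unary using (Pred; U; _∈_; _∉_; _⊆_; _∩_; ∁; _≐_; Satisfiable)

open Equivalence using (to; from)

-- Kuratowski pairs in `V X` and the bounded formulas that define them.

isDoubleton : ∀ {n} → Fin n → Fin n → Fin n → BoundedFormula n
isDoubleton w x y =
  (x `∈ w) `∧ ((y `∈ w) `∧ `∀∈ w ((zero `= suc x) `∨ (zero `= suc y)))

isPair : ∀ {n} → Fin n → Fin n → Fin n → BoundedFormula n
isPair w x y = `∃∈ w (`∃∈ (suc w)
  (isDoubleton (suc zero) (suc (suc x)) (suc (suc x)) `∧
  (isDoubleton zero (suc (suc x)) (suc (suc y)) `∧
   isDoubleton (suc (suc w)) (suc zero) zero)))

related₂ : ∀ {n} → Fin n → Fin n → Fin n → BoundedFormula n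
related₂ r x y = `∃∈ r (isPair zero (suc x) (suc y))

-- A quantifier needs a bound in scope, so the inner pair is reached from the triple in two steps:
-- `⟨ y , z ⟩` is a member of `⟅ x , ⟨ y , z ⟩ ⟆`, itself a member of `⟨ x , ⟨ y , z ⟩ ⟩`.
related₃ : ∀ {n} → Fin n → Fin n → Fin n → Fin n → BoundedFormula n
related₃ r x y z = `∃∈ r (`∃∈ zero (`∃∈ zero
  (isPair zero (suc (suc (suc y))) (suc (suc (suc z))) `∧
   isPair (suc (suc zero)) (suc (suc (suc x))) zero)))

module _ {X : Set} where

  ∈ⱽ-respˡ : {v v′ w : V X} → v ≈ⱽ v′ → v ∈ⱽ w → v′ ∈ⱽ w
  ∈ⱽ-respˡ {v} {v′} {w} e (j , d) = j , ≈ⱽ-trans v′ v (at w j) (≈ⱽ-sym v v′ e) d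

  ⟅⟆-cong : {a b c d : V X} → a ≈ⱽ c → b ≈ⱽ d → ⟅ a , b ⟆ ≈ⱽ ⟅ c , d ⟆
  ⟅⟆-cong p q = (λ { true → true , p ; false → false , q }) ,
                (λ { true → true , p ; false → false , q })

  ⟨⟩-cong : {a b c d : V X} → a ≈ⱽ c → b ≈ⱽ d → ⟨ a , b ⟩ ≈ⱽ ⟨ c , d ⟩
  ⟨⟩-cong p q = ⟅⟆-cong (⟅⟆-cong p p) (⟅⟆-cong p q)

  private
    _⨾_ : {u v w : V X} → u ≈ⱽ v → v ≈ⱽ w → u ≈ⱽ w
    _⨾_ {u} {v} {w} = ≈ⱽ-trans u v w

    ! : {v w : V X} → v ≈ⱽ w → w ≈ⱽ v
    ! {v} {w} = ≈ⱽ-sym v w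

  left∈⟅⟆ : {a b w : V X} → ⟅ a , b ⟆ ≈ⱽ w → a ∈ⱽ w
  left∈⟅⟆ {a} {b} {set _ _} (l , _) = l true

  right∈⟅⟆ : {a b w : V X} → ⟅ a , b ⟆ ≈ⱽ w → b ∈ⱽ w
  right∈⟅⟆ {a} {b} {set _ _} (l , _) = l false

  ∈⟅⟆ : {t c d : V X} → t ∈ⱽ ⟅ c , d ⟆ → t ≈ⱽ c ⊎ t ≈ⱽ d
  ∈⟅⟆ (true  , e) = inj₁ e
  ∈⟅⟆ (false , e) = inj₂ e

  ⟅⟆-diagonal : {a b c : V X} → ⟅ a , b ⟆ ≈ⱽ ⟅ c , c ⟆ → a ≈ⱽ c × b ≈ⱽ c
  ⟅⟆-diagonal {a} {b} {c} e =
    [ id , id ]′ (∈⟅⟆ {a} {c} {c} (left∈⟅⟆ {a} {b} {⟅ c , c ⟆} e)) ,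
    [ id , id ]′ (∈⟅⟆ {b} {c} {c} (right∈⟅⟆ {a} {b} {⟅ c , c ⟆} e))

  -- If `b` falls on `c` instead of `d`, then `d` in turn falls on `a` or `b`; as `a ≈ⱽ c`, both
  -- give `b ≈ⱽ d`.
  ⟅⟆-cancelˡ : {a b c d : V X} → a ≈ⱽ c → ⟅ a , b ⟆ ≈ⱽ ⟅ c , d ⟆ → b ≈ⱽ d
  ⟅⟆-cancelˡ {a} {b} {c} {d} p e
    with ∈⟅⟆ {b} {c} {d} (right∈⟅⟆ {a} {b} {⟅ c , d ⟆} e)
  ... | inj₂ q = q
  ... | inj₁ q
    with ∈⟅⟆ {d} {a} {b} (right∈⟅⟆ {c} {d} {⟅ a , b ⟆} (! {⟅ a , b ⟆} {⟅ c , d ⟆} e))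
  ...   | inj₂ r = ! {d} {b} r
  ...   | inj₁ r = _⨾_ {b} {c} {d} q (! {d} {c} (_⨾_ {d} {a} {c} r p))

  ⟨⟩-injective : {a b c d : V X} → ⟨ a , b ⟩ ≈ⱽ ⟨ c , d ⟩ → a ≈ⱽ c × b ≈ⱽ d
  ⟨⟩-injective {a} {b} {c} {d} e = a≈c , ⟅⟆-cancelˡ {a} {b} {c} {d} a≈c ab≈cd
    where
    a≈c : a ≈ⱽ c
    a≈c with ∈⟅⟆ {⟅ a , a ⟆} {⟅ c , c ⟆} {⟅ c , d ⟆}
               (left∈⟅⟆ {⟅ a , a ⟆} {⟅ a , b ⟆} {⟨ c , d ⟩} e)
    ... | inj₁ p = proj₁ (⟅⟆-diagonal {a} {a} {c} p)
    ... | inj₂ p = ! {c} {a} (proj₁ (⟅⟆-diagonal {c} {d} {a} (! {⟅ a , a ⟆} {⟅ c , d ⟆} p)))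
    ab≈cd : ⟅ a , b ⟆ ≈ⱽ ⟅ c , d ⟆
    ab≈cd = ⟅⟆-cancelˡ {⟅ a , a ⟆} {⟅ a , b ⟆} {⟅ c , c ⟆} {⟅ c , d ⟆}
              (⟅⟆-cong {a} {a} {c} {c} a≈c a≈c) e

  atom∈⌜⌝ : {A : Pred X 0ℓ} {x : X} → A x ⇔ atom x ∈ⱽ ⌜ A ⌝
  atom∈⌜⌝ {A} {x} = mk⇔ (λ a → (x , a) , refl) (λ { ((_ , a) , refl) → a })

  pair∈⌜⌝₂ : {R : X → X → Set} {x y : X} → R x y ⇔ ⟨ atom x , atom y ⟩ ∈ⱽ ⌜ R ⌝₂
  pair∈⌜⌝₂ {R} {x} {y} =
    mk⇔ (λ r → (x , y , r) , ≈ⱽ-refl ⟨ atom x , atom y ⟩) λ { ((x′ , y′ , r) , e) → back r e }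
    where
    back : ∀ {x′ y′} → R x′ y′ → ⟨ atom x , atom y ⟩ ≈ⱽ ⟨ atom x′ , atom y′ ⟩ → R x y
    back {x′} {y′} r e with ⟨⟩-injective {atom x} {atom y} {atom x′} {atom y′} e
    ... | refl , refl = r

  triple∈⌜⌝₃ : {R : X → X → X → Set} {x y z : X} →
               R x y z ⇔ ⟨ atom x , ⟨ atom y , atom z ⟩ ⟩ ∈ⱽ ⌜ R ⌝₃
  triple∈⌜⌝₃ {R} {x} {y} {z} =
    mk⇔ (λ r → (x , y , z , r) , ≈ⱽ-refl ⟨ atom x , ⟨ atom y , atom z ⟩ ⟩)
        λ { ((x′ , y′ , z′ , r) , e) → back r e }
    where
    back : ∀ {x′ y′ z′} → R x′ y′ z′ →
           ⟨ atom x , ⟨ atom y , atom z ⟩ ⟩ ≈ⱽ ⟨ atom x′ , ⟨ atom y′ , atom z′ ⟩ ⟩ → R x y z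
    back {x′} {y′} {z′} r e
      with ⟨⟩-injective {atom x} {⟨ atom y , atom z ⟩} {atom x′} {⟨ atom y′ , atom z′ ⟩} e
    ... | refl , d with ⟨⟩-injective {atom y} {atom z} {atom y′} {atom z′} d
    ... | refl , refl = r

  isDoubleton-sound : ∀ {n} (ρ : Vector (V X) n) w x y →
    ⟦ isDoubleton w x y ⟧ᵇ ρ ⇔ ⟅ ρ x , ρ y ⟆ ≈ⱽ ρ w
  isDoubleton-sound ρ w x y = mk⇔ (λ (p , q , r) → go (ρ w) p q r)
    (λ e → left∈⟅⟆ {ρ x} {ρ y} {ρ w} e , right∈⟅⟆ {ρ x} {ρ y} {ρ w} e , rest (ρ w) e)
    where
    go : ∀ v → ρ x ∈ⱽ v → ρ y ∈ⱽ v → (∀ j → at v j ≈ⱽ ρ x ⊎ at v j ≈ⱽ ρ y) →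
         ⟅ ρ x , ρ y ⟆ ≈ⱽ v
    go (set _ f) p q r = (λ { true → p ; false → q }) ,
      λ j → [ (λ e → true , ! {f j} {ρ x} e) , (λ e → false , ! {f j} {ρ y} e) ]′ (r j)
    rest : ∀ v → ⟅ ρ x , ρ y ⟆ ≈ⱽ v → ∀ j → at v j ≈ⱽ ρ x ⊎ at v j ≈ⱽ ρ y
    rest (set _ f) (_ , r) j with r j
    ... | true  , e = inj₁ (! {ρ x} {f j} e)
    ... | false , e = inj₂ (! {ρ y} {f j} e)

  isPair-sound : ∀ {n} (ρ : Vector (V X) n) w x y →
    ⟦ isPair w x y ⟧ᵇ ρ ⇔ ⟨ ρ x , ρ y ⟩ ≈ⱽ ρ w
  isPair-sound ρ w x y = mk⇔ fwd bwd
    where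
    ρ₂ : Ix (ρ w) → Ix (ρ w) → Vector (V X) _
    ρ₂ i j = at (ρ w) j ∷ at (ρ w) i ∷ ρ
    fwd : ⟦ isPair w x y ⟧ᵇ ρ → ⟨ ρ x , ρ y ⟩ ≈ⱽ ρ w
    fwd (i , j , p , q , r) =
      _⨾_ {⟨ ρ x , ρ y ⟩} {⟅ at (ρ w) i , at (ρ w) j ⟆} {ρ w}
        (⟅⟆-cong {_} {_} {at (ρ w) i} {at (ρ w) j}
          (to (isDoubleton-sound (ρ₂ i j) (suc zero) (suc (suc x)) (suc (suc x))) p)
          (to (isDoubleton-sound (ρ₂ i j) zero (suc (suc x)) (suc (suc y))) q))
        (to (isDoubleton-sound (ρ₂ i j) (suc (suc w)) (suc zero) zero) r)
    bwd : ⟨ ρ x , ρ y ⟩ ≈ⱽ ρ w → ⟦ isPair w x y ⟧ᵇ ρ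
    bwd e with left∈⟅⟆ {⟅ ρ x , ρ x ⟆} {⟅ ρ x , ρ y ⟆} {ρ w} e
             | right∈⟅⟆ {⟅ ρ x , ρ x ⟆} {⟅ ρ x , ρ y ⟆} {ρ w} e
    ... | i , p | j , q = i , j ,
      from (isDoubleton-sound (ρ₂ i j) (suc zero) (suc (suc x)) (suc (suc x))) p ,
      from (isDoubleton-sound (ρ₂ i j) zero (suc (suc x)) (suc (suc y))) q ,
      from (isDoubleton-sound (ρ₂ i j) (suc (suc w)) (suc zero) zero)
        (_⨾_ {⟅ at (ρ w) i , at (ρ w) j ⟆} {⟨ ρ x , ρ y ⟩} {ρ w}
          (! {⟨ ρ x , ρ y ⟩} {⟅ at (ρ w) i , at (ρ w) j ⟆}
            (⟅⟆-cong {_} {_} {at (ρ w) i} {at (ρ w) j} p q)) e)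

  related₂-sound : ∀ {n} (ρ : Vector (V X) n) r x y →
    ⟦ related₂ r x y ⟧ᵇ ρ ⇔ ⟨ ρ x , ρ y ⟩ ∈ⱽ ρ r
  related₂-sound ρ r x y = mk⇔
    (λ (j , p) → j , to (isPair-sound (at (ρ r) j ∷ ρ) zero (suc x) (suc y)) p)
    (λ (j , p) → j , from (isPair-sound (at (ρ r) j ∷ ρ) zero (suc x) (suc y)) p)

  related₃-sound : ∀ {n} (ρ : Vector (V X) n) r x y z →
    ⟦ related₃ r x y z ⟧ᵇ ρ ⇔ ⟨ ρ x , ⟨ ρ y , ρ z ⟩ ⟩ ∈ⱽ ρ r
  related₃-sound ρ r x y z = mk⇔ fwd bwd
    where
    ρ₃ : ∀ i j → Ix (at (at (ρ r) i) j) → Vector (V X) _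
    ρ₃ i j k = at (at (at (ρ r) i) j) k ∷ at (at (ρ r) i) j ∷ at (ρ r) i ∷ ρ
    fwd : ⟦ related₃ r x y z ⟧ᵇ ρ → ⟨ ρ x , ⟨ ρ y , ρ z ⟩ ⟩ ∈ⱽ ρ r
    fwd (i , j , k , p , q) = i ,
      _⨾_ {⟨ ρ x , ⟨ ρ y , ρ z ⟩ ⟩} {⟨ ρ x , at (at (at (ρ r) i) j) k ⟩} {at (ρ r) i}
        (⟨⟩-cong {ρ x} {⟨ ρ y , ρ z ⟩} {ρ x} {at (at (at (ρ r) i) j) k}
          (≈ⱽ-refl (ρ x)) (to (isPair-sound (ρ₃ i j k) zero (suc (suc (suc y))) (suc (suc (suc z)))) p))
        (to (isPair-sound (ρ₃ i j k) (suc (suc zero)) (suc (suc (suc x))) zero) q)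
    bwd : ⟨ ρ x , ⟨ ρ y , ρ z ⟩ ⟩ ∈ⱽ ρ r → ⟦ related₃ r x y z ⟧ᵇ ρ
    bwd (i , e) with right∈⟅⟆ {⟅ ρ x , ρ x ⟆} {⟅ ρ x , ⟨ ρ y , ρ z ⟩ ⟆} {at (ρ r) i} e
    ... | j , d with right∈⟅⟆ {ρ x} {⟨ ρ y , ρ z ⟩} {at (at (ρ r) i) j} d
    ... | k , c = i , j , k ,
      from (isPair-sound (ρ₃ i j k) zero (suc (suc (suc y))) (suc (suc (suc z)))) c ,
      from (isPair-sound (ρ₃ i j k) (suc (suc zero)) (suc (suc (suc x))) zero)
        (_⨾_ {⟨ ρ x , at (at (at (ρ r) i) j) k ⟩} {⟨ ρ x , ⟨ ρ y , ρ z ⟩ ⟩} {at (ρ r) i}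
          (⟨⟩-cong {ρ x} {at (at (at (ρ r) i) j) k} {ρ x} {⟨ ρ y , ρ z ⟩}
            (≈ⱽ-refl (ρ x)) (! {⟨ ρ y , ρ z ⟩} {at (at (at (ρ r) i) j) k} c)) e)

-- First-order logic over ℕ⁺ and its translation into bounded formulas.

infixr 4 _⨟_

_⨟_ : ∀ {a b c} {A : Set a} {B : Set b} {C : Set c} → A ⇔ B → B ⇔ C → A ⇔ C
p ⨟ q = mk⇔ (to q ∘ to p) (from p ∘ from q)

-- First-order formulas over ℕ⁺ in which every relation on ℕ⁺ is a symbol.
data Φ (n : ℕ) : Set₁ where
  P₁               : Pred ℕ⁺ 0ℓ → Fin n → Φ n
  P₂               : (ℕ⁺ → ℕ⁺ → Set) → Fin n → Fin n → Φ n
  P₃               : (ℕ⁺ → ℕ⁺ → ℕ⁺ → Set) → Fin n → Fin n → Fin n → Φ n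
  _≋_              : Fin n → Fin n → Φ n
  ~_               : Φ n → Φ n
  _∧_ _∨_ _⇒_      : Φ n → Φ n → Φ n
  Α Ε              : Φ (suc n) → Φ n

infix  7 _≋_
infix  6 ~_
infixr 5 _∧_
infixr 4 _∨_
infixr 3 _⇒_

record Structure : Set₁ where
  field
    Dom : Set
    I₁  : Pred ℕ⁺ 0ℓ → Dom → Set
    I₂  : (ℕ⁺ → ℕ⁺ → Set) → Dom → Dom → Set
    I₃  : (ℕ⁺ → ℕ⁺ → ℕ⁺ → Set) → Dom → Dom → Dom → Set

module Semantics (M : Structure) where
  open Structure M

  ⟦_⟧ : ∀ {n} → Φ n → Vector Dom n → Set
  ⟦ P₁ A x ⟧ e     = I₁ A (e x)
  ⟦ P₂ R x y ⟧ e   = I₂ R (e x) (e y)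
  ⟦ P₃ R x y z ⟧ e = I₃ R (e x) (e y) (e z)
  ⟦ x ≋ y ⟧ e      = e x ≡ e y
  ⟦ ~ φ ⟧ e        = ¬ ⟦ φ ⟧ e
  ⟦ φ ∧ ψ ⟧ e      = ⟦ φ ⟧ e × ⟦ ψ ⟧ e
  ⟦ φ ∨ ψ ⟧ e      = ⟦ φ ⟧ e ⊎ ⟦ ψ ⟧ e
  ⟦ φ ⇒ ψ ⟧ e      = ⟦ φ ⟧ e → ⟦ ψ ⟧ e
  ⟦ Α φ ⟧ e        = ∀ x → ⟦ φ ⟧ (x ∷ e)
  ⟦ Ε φ ⟧ e        = ∃[ x ] ⟦ φ ⟧ (x ∷ e)

-- A bounded formula has no relation symbols: relations can only be values of its variables. One
-- variable is reserved for each occurrence, repetitions included.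
symbolCount : ∀ {n} → Φ n → ℕ
symbolCount (P₁ _ _)     = 1
symbolCount (P₂ _ _ _)   = 1
symbolCount (P₃ _ _ _ _) = 1
symbolCount (_ ≋ _)      = 0
symbolCount (~ φ)        = symbolCount φ
symbolCount (φ ∧ ψ)      = symbolCount φ ℕ.+ symbolCount ψ
symbolCount (φ ∨ ψ)      = symbolCount φ ℕ.+ symbolCount ψ
symbolCount (φ ⇒ ψ)      = symbolCount φ ℕ.+ symbolCount ψ
symbolCount (Α φ)        = symbolCount φ
symbolCount (Ε φ)        = symbolCount φ

symbols : ∀ {n} (φ : Φ n) → Vector (V ℕ⁺) (symbolCount φ)
symbols (P₁ A _)     = λ _ → ⌜ A ⌝
symbols (P₂ R _ _)   = λ _ → ⌜ R ⌝₂
symbols (P₃ R _ _ _) = λ _ → ⌜ R ⌝₃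
symbols (_ ≋ _)      = λ ()
symbols (~ φ)        = symbols φ
symbols (φ ∧ ψ)      = symbols φ ++ symbols ψ
symbols (φ ∨ ψ)      = symbols φ ++ symbols ψ
symbols (φ ⇒ ψ)      = symbols φ ++ symbols ψ
symbols (Α φ)        = symbols φ
symbols (Ε φ)        = symbols φ

-- θ, σ and b locate the symbols, the variables and the set of all numbers.
compile : ∀ {n N} (φ : Φ n) → (Fin (symbolCount φ) → Fin N) → (Fin n → Fin N) → Fin N →
          BoundedFormula N
compile (P₁ A x) θ σ b     = σ x `∈ θ zero
compile (P₂ R x y) θ σ b   = related₂ (θ zero) (σ x) (σ y)
compile (P₃ R x y z) θ σ b = related₃ (θ zero) (σ x) (σ y) (σ z)
compile (x ≋ y) θ σ b      = σ x `= σ y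
compile (~ φ) θ σ b        = `¬ compile φ θ σ b
compile (φ ∧ ψ) θ σ b      = compile φ (θ ∘ (_↑ˡ _)) σ b `∧ compile ψ (θ ∘ (_ ↑ʳ_)) σ b
compile (φ ∨ ψ) θ σ b      = compile φ (θ ∘ (_↑ˡ _)) σ b `∨ compile ψ (θ ∘ (_ ↑ʳ_)) σ b
compile (φ ⇒ ψ) θ σ b      = compile φ (θ ∘ (_↑ˡ _)) σ b `⇒ compile ψ (θ ∘ (_ ↑ʳ_)) σ b
compile (Α φ) θ σ b        = `∀∈ b (compile φ (suc ∘ θ) (zero ∷ suc ∘ σ) (suc b))
compile (Ε φ) θ σ b        = `∃∈ b (compile φ (suc ∘ θ) (zero ∷ suc ∘ σ) (suc b))

element-atom : ∀ {X} (v : V X) → v ≈ⱽ ⌜ U ⌝ → ∀ j → ∃[ x ] at v j ≈ⱽ atom x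
element-atom (set _ _) (l , _) j = let ((x , _) , d) = l j in x , d

atom-element : ∀ {X} (v : V X) → v ≈ⱽ ⌜ U ⌝ → ∀ x → ∃[ j ] at v j ≈ⱽ atom x
atom-element (set _ _) (_ , r) x = r (x , tt)

module Interpretation (M : Structure) where
  open Structure M
  open Semantics M

  module _
    (int : V ℕ⁺ → V Dom)
    (base : int ⌜ U ⌝ ≈ⱽ ⌜ U ⌝)
    (sound₁ : ∀ {A x} → I₁ A x ⇔ atom x ∈ⱽ int ⌜ A ⌝)
    (sound₂ : ∀ {R x y} → I₂ R x y ⇔ ⟨ atom x , atom y ⟩ ∈ⱽ int ⌜ R ⌝₂)
    (sound₃ : ∀ {R x y z} → I₃ R x y z ⇔ ⟨ atom x , ⟨ atom y , atom z ⟩ ⟩ ∈ⱽ int ⌜ R ⌝₃)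
    where

    ∈ⱽ-cong : {v v′ w w′ : V Dom} → v ≈ⱽ v′ → w ≡ w′ → v ∈ⱽ w ⇔ v′ ∈ⱽ w′
    ∈ⱽ-cong {v} {v′} {w} p refl =
      mk⇔ (∈ⱽ-respˡ {v = v} {v′} {w} p) (∈ⱽ-respˡ {v = v′} {v} {w} (≈ⱽ-sym v v′ p))

    -- Parametrised by `int` to cover both sides of transfer, `id` over ℕ⁺ and `⋆_` over ⋆ℕ.
    -- Variables match only up to `≈ⱽ`, because a bound variable ranges over the members of
    -- `int ⌜ U ⌝`, which are known to be atoms only up to `≈ⱽ`.
    compile-sound : ∀ {n N} (φ : Φ n) (ρ : Vector (V Dom) N) (e : Vector Dom n)
      (θ : Fin (symbolCount φ) → Fin N) (σ : Fin n → Fin N) (b : Fin N) →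
      (∀ k → ρ (θ k) ≡ int (symbols φ k)) → (∀ i → atom (e i) ≈ⱽ ρ (σ i)) → ρ b ≡ int ⌜ U ⌝ →
      ⟦ φ ⟧ e ⇔ ⟦ compile φ θ σ b ⟧ᵇ ρ
    compile-sound (P₁ A x) ρ e θ σ b hθ hσ hb =
      sound₁ ⨟ ∈ⱽ-cong {atom (e x)} {ρ (σ x)} (hσ x) (sym (hθ zero))
    compile-sound (P₂ R x y) ρ e θ σ b hθ hσ hb =
      sound₂ ⨟ (∈ⱽ-cong {⟨ atom (e x) , atom (e y) ⟩} {⟨ ρ (σ x) , ρ (σ y) ⟩}
        (⟨⟩-cong {_} {atom (e x)} {atom (e y)} {ρ (σ x)} {ρ (σ y)} (hσ x) (hσ y)) (sym (hθ zero))
      ⨟ ⇔-sym (related₂-sound ρ (θ zero) (σ x) (σ y)))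
    compile-sound (P₃ R x y z) ρ e θ σ b hθ hσ hb =
      sound₃ ⨟ (∈ⱽ-cong {⟨ atom (e x) , ⟨ atom (e y) , atom (e z) ⟩ ⟩}
          {⟨ ρ (σ x) , ⟨ ρ (σ y) , ρ (σ z) ⟩ ⟩}
        (⟨⟩-cong {_} {atom (e x)} {⟨ atom (e y) , atom (e z) ⟩} {ρ (σ x)} {⟨ ρ (σ y) , ρ (σ z) ⟩} (hσ x)
          (⟨⟩-cong {_} {atom (e y)} {atom (e z)} {ρ (σ y)} {ρ (σ z)} (hσ y) (hσ z))) (sym (hθ zero))
      ⨟ ⇔-sym (related₃-sound ρ (θ zero) (σ x) (σ y) (σ z)))
    compile-sound (x ≋ y) ρ e θ σ b hθ hσ hb = mk⇔
      (λ { p → ≈ⱽ-trans (ρ (σ x)) (atom (e x)) (ρ (σ y)) (≈ⱽ-sym (atom (e x)) (ρ (σ x)) (hσ x))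
                 (≈ⱽ-trans (atom (e x)) (atom (e y)) (ρ (σ y)) p (hσ y)) })
      (λ p → ≈ⱽ-trans (atom (e x)) (ρ (σ x)) (atom (e y)) (hσ x)
               (≈ⱽ-trans (ρ (σ x)) (ρ (σ y)) (atom (e y)) p (≈ⱽ-sym (atom (e y)) (ρ (σ y)) (hσ y))))
    compile-sound (~ φ) ρ e θ σ b hθ hσ hb = ¬-cong-⇔ (compile-sound φ ρ e θ σ b hθ hσ hb)
    compile-sound (φ ∧ ψ) ρ e θ σ b hθ hσ hb =
      compile-sound φ ρ e _ σ b (λ k → trans (hθ _) (cong int (lookup-++ˡ (symbols φ) (symbols ψ) k))) hσ hb ×-⇔
      compile-sound ψ ρ e _ σ b (λ k → trans (hθ _) (cong int (lookup-++ʳ (symbols φ) (symbols ψ) k))) hσ hb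
    compile-sound (φ ∨ ψ) ρ e θ σ b hθ hσ hb =
      compile-sound φ ρ e _ σ b (λ k → trans (hθ _) (cong int (lookup-++ˡ (symbols φ) (symbols ψ) k))) hσ hb ⊎-⇔
      compile-sound ψ ρ e _ σ b (λ k → trans (hθ _) (cong int (lookup-++ʳ (symbols φ) (symbols ψ) k))) hσ hb
    compile-sound (φ ⇒ ψ) ρ e θ σ b hθ hσ hb =
      →-cong-⇔
      (compile-sound φ ρ e _ σ b (λ k → trans (hθ _) (cong int (lookup-++ˡ (symbols φ) (symbols ψ) k))) hσ hb)
      (compile-sound ψ ρ e _ σ b (λ k → trans (hθ _) (cong int (lookup-++ʳ (symbols φ) (symbols ψ) k))) hσ hb)
    compile-sound {n} {N} (Α φ) ρ e θ σ b hθ hσ hb = mk⇔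
      (λ h j → let (x , d) = element-atom (ρ b) b≈ j in
               to (step j x d) (h x))
      (λ h x → let (j , d) = atom-element (ρ b) b≈ x in
               from (step j x d) (h j))
      where
      b≈ : ρ b ≈ⱽ ⌜ U ⌝
      b≈ = subst (_≈ⱽ ⌜ U ⌝) (sym hb) base
      step : ∀ j x → at (ρ b) j ≈ⱽ atom x →
        ⟦ φ ⟧ (x ∷ e) ⇔ ⟦ compile φ (suc ∘ θ) (zero ∷ suc ∘ σ) (suc b) ⟧ᵇ (at (ρ b) j ∷ ρ)
      step j x d = compile-sound φ (at (ρ b) j ∷ ρ) (x ∷ e) (suc ∘ θ) (zero ∷ suc ∘ σ) (suc b) hθ
        (λ { zero → ≈ⱽ-sym (at (ρ b) j) (atom x) d ; (suc i) → hσ i }) hb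
    compile-sound {n} {N} (Ε φ) ρ e θ σ b hθ hσ hb = mk⇔
      (λ (x , h) → let (j , d) = atom-element (ρ b) b≈ x in
                   j , to (step j x d) h)
      (λ (j , h) → let (x , d) = element-atom (ρ b) b≈ j in
                   x , from (step j x d) h)
      where
      b≈ : ρ b ≈ⱽ ⌜ U ⌝
      b≈ = subst (_≈ⱽ ⌜ U ⌝) (sym hb) base
      step : ∀ j x → at (ρ b) j ≈ⱽ atom x →
        ⟦ φ ⟧ (x ∷ e) ⇔ ⟦ compile φ (suc ∘ θ) (zero ∷ suc ∘ σ) (suc b) ⟧ᵇ (at (ρ b) j ∷ ρ)
      step j x d = compile-sound φ (at (ρ b) j ∷ ρ) (x ∷ e) (suc ∘ θ) (zero ∷ suc ∘ σ) (suc b) hθ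
        (λ { zero → ≈ⱽ-sym (at (ρ b) j) (atom x) d ; (suc i) → hσ i }) hb

standard : Structure
standard = record { Dom = ℕ⁺ ; I₁ = λ A → A ; I₂ = λ R → R ; I₃ = λ R → R }

Rank≤-⟅⟆ : ∀ {X n} {v w : V X} → Rank≤ n v → Rank≤ n w → Rank≤ (suc n) ⟅ v , w ⟆
Rank≤-⟅⟆ p q true  = p
Rank≤-⟅⟆ p q false = q

Rank≤-⟨⟩ : ∀ {X n} {v w : V X} → Rank≤ n v → Rank≤ n w → Rank≤ (suc (suc n)) ⟨ v , w ⟩
Rank≤-⟨⟩ {n = n} {v} {w} p q =
  Rank≤-⟅⟆ {n = suc n} {⟅ v , v ⟆} {⟅ v , w ⟆}
    (Rank≤-⟅⟆ {n = n} {v} {v} p p) (Rank≤-⟅⟆ {n = n} {v} {w} p q)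

⌜⌝-finite : ∀ {X} (A : Pred X 0ℓ) → FiniteRank ⌜ A ⌝
⌜⌝-finite A = 1 , λ _ → tt

⌜⌝₂-finite : ∀ {X} (R : X → X → Set) → FiniteRank ⌜ R ⌝₂
⌜⌝₂-finite R = 3 , λ (x , y , _) → Rank≤-⟨⟩ {n = 0} {atom x} {atom y} tt tt

⌜⌝₃-finite : ∀ {X} (R : X → X → X → Set) → FiniteRank ⌜ R ⌝₃
⌜⌝₃-finite R = 5 , λ (x , y , z , _) →
  Rank≤-⟨⟩ {n = 2} {atom x} {⟨ atom y , atom z ⟩} tt (Rank≤-⟨⟩ {n = 0} {atom y} {atom z} tt tt)

++-all : ∀ {a p} {A : Set a} (P : A → Set p) {m n} (xs : Vector A m) (ys : Vector A n) →
         (∀ i → P (xs i)) → (∀ i → P (ys i)) → ∀ i → P ((xs ++ ys) i)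
++-all P {m} xs ys p q i with splitAt m i
... | inj₁ j = p j
... | inj₂ j = q j

symbols-finite : ∀ {n} (φ : Φ n) k → FiniteRank (symbols φ k)
symbols-finite (P₁ A _)     _ = ⌜⌝-finite A
symbols-finite (P₂ R _ _)   _ = ⌜⌝₂-finite R
symbols-finite (P₃ R _ _ _) _ = ⌜⌝₃-finite R
symbols-finite (~ φ)          = symbols-finite φ
symbols-finite (φ ∧ ψ)        = ++-all FiniteRank _ _ (symbols-finite φ) (symbols-finite ψ)
symbols-finite (φ ∨ ψ)        = ++-all FiniteRank _ _ (symbols-finite φ) (symbols-finite ψ)
symbols-finite (φ ⇒ ψ)        = ++-all FiniteRank _ _ (symbols-finite φ) (symbols-finite ψ)
symbols-finite (Α φ)          = symbols-finite φ
symbols-finite (Ε φ)          = symbols-finite φ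

-- Transfer of first-order statements, and internal sections of relations.

module Transfer (E : NonstandardExtension) where
  open NonstandardExtension E
  open Extension E

  -- Opaque, so that conversion checks do not unfold transferred statements.
  opaque
    I⋆₂ : (ℕ⁺ → ℕ⁺ → Set) → ⋆ℕ → ⋆ℕ → Set
    I⋆₂ R x y = ⟨ atom x , atom y ⟩ ∈ⱽ ⋆ ⌜ R ⌝₂

    I⋆₃ : (ℕ⁺ → ℕ⁺ → ℕ⁺ → Set) → ⋆ℕ → ⋆ℕ → ⋆ℕ → Set
    I⋆₃ R x y z = ⟨ atom x , ⟨ atom y , atom z ⟩ ⟩ ∈ⱽ ⋆ ⌜ R ⌝₃

    I⋆₂-sound : ∀ {R x y} → I⋆₂ R x y ⇔ ⟨ atom x , atom y ⟩ ∈ⱽ ⋆ ⌜ R ⌝₂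
    I⋆₂-sound = ⇔-id _

    I⋆₃-sound : ∀ {R x y z} → I⋆₃ R x y z ⇔ ⟨ atom x , ⟨ atom y , atom z ⟩ ⟩ ∈ⱽ ⋆ ⌜ R ⌝₃
    I⋆₃-sound = ⇔-id _

  nonstandard : Structure
  nonstandard = record { Dom = ⋆ℕ ; I₁ = λ A x → x ∈⋆ A ; I₂ = I⋆₂ ; I₃ = I⋆₃ }

  open Semantics standard    using () renaming (⟦_⟧ to ⟦_⟧ˢ)
  open Semantics nonstandard using () renaming (⟦_⟧ to ⟦_⟧⋆)

  opaque
    -- Bounded transfer is applied to the compiled formula, with the base set, the relations of `φ`
    -- and the numbers `e` as parameters; soundness of compilation on either side turns it into a
    -- statement about `φ`.
    transferᶠ : ∀ {n} (φ : Φ n) (e : Vector ℕ⁺ n) → ⟦ φ ⟧ˢ e ⇔ ⟦ φ ⟧⋆ (ι ∘ e)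
    transferᶠ {n} φ e =
      Interpretation.compile-sound standard id (≈ⱽ-refl ⌜ U ⌝) atom∈⌜⌝ pair∈⌜⌝₂ triple∈⌜⌝₃
        φ ρ e θ σ zero (lookup-++ˡ (symbols φ) (atom ∘ e))
        (λ i → ≡⇒≈ (sym (lookup-++ʳ (symbols φ) (atom ∘ e) i))) refl
      ⨟ (transfer (compile φ θ σ zero) ρ finite
      ⨟ ⇔-sym (Interpretation.compile-sound nonstandard ⋆_ ⋆-base (⇔-id _) I⋆₂-sound I⋆₃-sound
        φ (λ k → ⋆ ρ k) (ι ∘ e) θ σ zero (λ k → cong ⋆_ (lookup-++ˡ (symbols φ) (atom ∘ e) k))
        (λ i → ≈ⱽ-trans (atom (ι (e i))) (⋆ (atom (e i))) (⋆ ρ (σ i))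
          (≈ⱽ-sym (⋆ (atom (e i))) (atom (ι (e i))) (⋆-atom (e i)))
          (≡⇒≈ (cong ⋆_ (sym (lookup-++ʳ (symbols φ) (atom ∘ e) i))))) refl))
      where
      ≡⇒≈ : ∀ {X} {v w : V X} → v ≡ w → v ≈ⱽ w
      ≡⇒≈ {v = v} refl = ≈ⱽ-refl v
      ρ : Vector (V ℕ⁺) (suc (symbolCount φ ℕ.+ n))
      ρ = ⌜ U ⌝ ∷ (symbols φ ++ (atom ∘ e))
      θ : Fin (symbolCount φ) → Fin (suc (symbolCount φ ℕ.+ n))
      θ k = suc (k ↑ˡ n)
      σ : Fin n → Fin (suc (symbolCount φ ℕ.+ n))
      σ i = suc (symbolCount φ ↑ʳ i)
      finite : ∀ k → FiniteRank (ρ k)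
      finite zero    = ⌜⌝-finite U
      finite (suc k) = ++-all FiniteRank (symbols φ) (atom ∘ e) (symbols-finite φ) (λ _ → 0 , tt) k

  module Sections (R : ℕ⁺ → ℕ⁺ → Set) where
    family : V ℕ⁺
    family = set ℕ⁺ (λ y → ⌜ R y ⌝)
    ρ : Vector (V ℕ⁺) 3
    ρ = ⌜ U ⌝ ∷ family ∷ ⌜ R ⌝₂ ∷ λ ()
    finite : ∀ k → FiniteRank (ρ k)
    finite zero             = ⌜⌝-finite U
    finite (suc zero)       = 2 , λ _ _ → tt
    finite (suc (suc zero)) = ⌜⌝₂-finite R
    -- Every `y` has some `B` in the family such that all members of `B` are numbers and, for all
    -- numbers `c`, `c ∈ B` iff `R y c`. The first clause survives transfer as the fact that members
    -- of a section are atoms.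
    sections : BoundedFormula 3
    sections = `∀∈ 0F (`∃∈ 2F (
      `∀∈ 0F (0F `∈ 3F) `∧
      `∀∈ 2F (((0F `∈ 1F) `⇒ related₂ 5F 2F 0F) `∧ (related₂ 5F 2F 0F `⇒ (0F `∈ 1F)))))
    hypothesis : ⟦ sections ⟧ᵇ ρ
    hypothesis (y , _) = y , (λ (c , _) → (c , tt) , refl) , λ (c , _) →
      (λ p → from (related₂-sound (atom c ∷ ⌜ R y ⌝ ∷ atom y ∷ ρ) 5F 2F 0F)
               (to pair∈⌜⌝₂ (from atom∈⌜⌝ p))) ,
      (λ p → to atom∈⌜⌝ (from pair∈⌜⌝₂
               (to (related₂-sound (atom c ∷ ⌜ R y ⌝ ∷ atom y ∷ ρ) 5F 2F 0F) p)))

    -- For nonstandard `y` the section need not be `⋆` of a standard set, yet it is internal: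
    -- transfer finds it among the members of `⋆ family`, where `family` collects the standard
    -- sections.
    section-internal : (y : ⋆ℕ) →
      ∃[ v ] (Internal v × (∀ w → w ∈ⱽ v → ∃[ c ] w ≈ⱽ atom c) ×
              (∀ c → atom c ∈ⱽ v ⇔ I⋆₂ R y c))
    section-internal y with atom-element (⋆ ⌜ U ⌝) ⋆-base y
    ... | j , y≈ with to (transfer sections ρ finite) hypothesis j
    ... | B , elements , members =
      v , (family , finite 1F , B , ≈ⱽ-refl v) , atoms , λ c → mk⇔ (forward c) (backward c)
      where
      v : V ⋆ℕ
      v = at (⋆ family) B
      atoms : ∀ w → w ∈ⱽ v → ∃[ c ] w ≈ⱽ atom c
      atoms w (j , w≈) = let (k , p) = elements j
                             (c , q) = element-atom (⋆ ⌜ U ⌝) ⋆-base k in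
        c , ≈ⱽ-trans w (at v j) (atom c) w≈ (≈ⱽ-trans (at v j) (at (⋆ ⌜ U ⌝) k) (atom c) p q)
      ρ′ : ∀ k → Vector (V ⋆ℕ) 6
      ρ′ k = at (⋆ ⌜ U ⌝) k ∷ v ∷ at (⋆ ⌜ U ⌝) j ∷ (λ i → ⋆ ρ i)
      forward : ∀ c → atom c ∈ⱽ v → I⋆₂ R y c
      forward c p = let (k , c≈) = atom-element (⋆ ⌜ U ⌝) ⋆-base c in
        from I⋆₂-sound (∈ⱽ-respˡ {v = ⟨ at (⋆ ⌜ U ⌝) j , at (⋆ ⌜ U ⌝) k ⟩} {⟨ atom y , atom c ⟩} {⋆ ⌜ R ⌝₂}
          (⟨⟩-cong {a = at (⋆ ⌜ U ⌝) j} {at (⋆ ⌜ U ⌝) k} {atom y} {atom c} y≈ c≈)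
          (to (related₂-sound (ρ′ k) 5F 2F 0F)
            (proj₁ (members k) (∈ⱽ-respˡ {v = atom c} {at (⋆ ⌜ U ⌝) k} {v}
                                 (≈ⱽ-sym (at (⋆ ⌜ U ⌝) k) (atom c) c≈) p))))
      backward : ∀ c → I⋆₂ R y c → atom c ∈ⱽ v
      backward c p = let (k , c≈) = atom-element (⋆ ⌜ U ⌝) ⋆-base c in
        ∈ⱽ-respˡ {v = at (⋆ ⌜ U ⌝) k} {atom c} {v} c≈
          (proj₂ (members k) (from (related₂-sound (ρ′ k) 5F 2F 0F)
            (∈ⱽ-respˡ {v = ⟨ atom y , atom c ⟩} {⟨ at (⋆ ⌜ U ⌝) j , at (⋆ ⌜ U ⌝) k ⟩} {⋆ ⌜ R ⌝₂}
              (≈ⱽ-sym ⟨ at (⋆ ⌜ U ⌝) j , at (⋆ ⌜ U ⌝) k ⟩ ⟨ atom y , atom c ⟩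
                (⟨⟩-cong {a = at (⋆ ⌜ U ⌝) j} {at (⋆ ⌜ U ⌝) k} {atom y} {atom c} y≈ c≈)) (to I⋆₂-sound p))))

  open Sections using (section-internal)

-- Exact prime power divisors of natural numbers.

ℕ⁺-≡ : ∀ {m n} → value m ≡ value n → m ≡ n
ℕ⁺-≡ {pos _} {pos _} refl = refl

value-nonZero : ∀ n → NonZero (value n)
value-nonZero (pos n {{n≢0}}) = recompute (ℕ.nonZero? n) n≢0

prime≢1 : ∀ {p} → ℕ.Prime p → ¬ p ≡ 1
prime≢1 pp refl = contradiction pp ℕ.¬prime[1]

prime∣^⇒≡ : ∀ {p q} → ℕ.Prime p → ℕ.Prime q → ∀ b → p ℕ.∣ q ℕ.^ b → p ≡ q
prime∣^⇒≡ pp pq zero h = contradiction (ℕ.∣1⇒≡1 h) (prime≢1 pp)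
prime∣^⇒≡ {p} {q} pp pq (suc b) h with ℕ.euclidsLemma q (q ℕ.^ b) pp h
... | inj₂ h′ = prime∣^⇒≡ pp pq b h′
... | inj₁ h′ with ℕ.prime⇒irreducible pq h′
...   | inj₁ p≡1 = contradiction p≡1 (prime≢1 pp)
...   | inj₂ p≡q = p≡q

∣^ : ∀ p n .{{_ : NonZero n}} → p ℕ.∣ p ℕ.^ n
∣^ p (suc n) = ℕ.m∣m*n (p ℕ.^ n)

exponent-unique : ∀ {p} → ℕ.Prime p → ∀ a b {x y} → ¬ p ℕ.∣ x → ¬ p ℕ.∣ y →
                  p ℕ.^ a ℕ.* x ≡ p ℕ.^ b ℕ.* y → a ≡ b
exponent-unique pp zero zero _ _ _ = refl
exponent-unique {p} pp zero (suc b) {x} {y} p∤x p∤y e =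
  contradiction (subst (p ℕ.∣_) (trans (sym e) (ℕ.*-identityˡ x))
    (ℕ.∣m⇒∣m*n y (ℕ.m∣m*n (p ℕ.^ b)))) p∤x
exponent-unique {p} pp (suc a) zero {x} {y} p∤x p∤y e =
  contradiction (subst (p ℕ.∣_) (trans e (ℕ.*-identityˡ y))
    (ℕ.∣m⇒∣m*n x (ℕ.m∣m*n (p ℕ.^ a)))) p∤y
exponent-unique {p} pp (suc a) (suc b) {x} {y} p∤x p∤y e =
  cong suc (exponent-unique pp a b p∤x p∤y
    (ℕ.*-cancelˡ-≡ _ _ p {{ℕ.prime⇒nonZero pp}}
      (trans (sym (ℕ.*-assoc p (p ℕ.^ a) x)) (trans e (ℕ.*-assoc p (p ℕ.^ b) y)))))

^∣*⇒^∣ : ∀ {q} → ℕ.Prime q → ∀ b {m n} → ¬ q ℕ.∣ m → q ℕ.^ b ℕ.∣ m ℕ.* n → q ℕ.^ b ℕ.∣ n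
^∣*⇒^∣ pq zero {n = n} _ _ = ℕ.1∣ n
^∣*⇒^∣ {q} pq (suc b) {m} {n} q∤m h with ℕ.euclidsLemma m n pq (ℕ.∣-trans (ℕ.m∣m*n (q ℕ.^ b)) h)
... | inj₁ q∣m = contradiction q∣m q∤m
... | inj₂ (ℕ.divides n′ refl) = subst (q ℕ.* q ℕ.^ b ℕ.∣_) (ℕ.*-comm q n′)
  (ℕ.*-monoʳ-∣ q (^∣*⇒^∣ pq b q∤m
    (ℕ.*-cancelˡ-∣ q {{ℕ.prime⇒nonZero pq}} (subst (q ℕ.* q ℕ.^ b ℕ.∣_) (rearrange m n′ q) h))))
  where
  rearrange : ∀ m n q → m ℕ.* (n ℕ.* q) ≡ q ℕ.* (m ℕ.* n)
  rearrange = solve-∀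

-- If `p` divides `d`, one factor is stripped from both sides. Otherwise Euclid's lemma puts it in
-- the complementary divisor `r`, and `d` already divides the smaller power.
divisor-of-prime-power : ∀ {p} → ℕ.Prime p → ∀ b {d} → d ℕ.∣ p ℕ.^ b → ∃[ k ] p ℕ.^ k ≡ d
divisor-of-prime-power pp zero h = 0 , sym (ℕ.∣1⇒≡1 h)
divisor-of-prime-power {p} pp (suc b) {d} h with p ℕ.∣? d
... | yes (ℕ.divides d′ refl) =
  let (k , e) = divisor-of-prime-power pp b
                  (ℕ.*-cancelˡ-∣ p {{ℕ.prime⇒nonZero pp}} (subst (ℕ._∣ p ℕ.* p ℕ.^ b) (ℕ.*-comm d′ p) h))
  in suc k , trans (cong (p ℕ.*_) e) (ℕ.*-comm p d′)
divisor-of-prime-power {p} pp (suc b) {d} (ℕ.divides r e) | no p∤d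
  with ℕ.euclidsLemma r d pp (subst (p ℕ.∣_) e (ℕ.m∣m*n (p ℕ.^ b)))
... | inj₂ p∣d = contradiction p∣d p∤d
... | inj₁ (ℕ.divides r′ refl) = divisor-of-prime-power pp b (ℕ.divides r′
  (ℕ.*-cancelˡ-≡ _ _ p {{ℕ.prime⇒nonZero pp}} (trans e (rearrange r′ p d))))
  where
  rearrange : ∀ r p d → r ℕ.* p ℕ.* d ≡ p ℕ.* (r ℕ.* d)
  rearrange = solve-∀

Product : ℕ⁺ → ℕ⁺ → ℕ⁺ → Set
Product k m n = value k ℕ.* value m ≡ value n

-- Exact divisibility of `x` by `p ^ a`, with the power `c` and the cofactor `y` as arguments so
-- that `y` can be divided again.
Part : ℕ⁺ → ℕ⁺ → ℕ⁺ → ℕ⁺ → ℕ⁺ → Set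
Part p a c y x = PowerOf p a c × Product c y x × ¬ p ∣⁺ y

power-exists : ∀ p a → ∃[ c ] PowerOf p a c
power-exists (pos p) (pos a) = pos (p ℕ.^ a) {{ℕ.m^n≢0 p a}} , refl

prime-power-unique : ∀ {p a q b c} → p ∈ Prime⁺ → q ∈ Prime⁺ → PowerOf p a c → PowerOf q b c →
                     p ≡ q × a ≡ b
prime-power-unique {p} {a} {q} {b} {c} pp pq p^a≡c q^b≡c
  with ℕ⁺-≡ {p} {q} (prime∣^⇒≡ pp pq (value b) (subst (value p ℕ.∣_) (trans p^a≡c (sym q^b≡c))
    (∣^ (value p) (value a) {{value-nonZero a}})))
... | refl = refl , ℕ⁺-≡ {a} {b} (exponent-unique pp (value a) (value b) {1} {1} p∤1 p∤1
      (cong (ℕ._* 1) (trans p^a≡c (sym q^b≡c))))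
  where
  p∤1 : ¬ value p ℕ.∣ 1
  p∤1 h = prime≢1 pp (ℕ.∣1⇒≡1 h)

power-∣ : ∀ {p a c y x} → Part p a c y x → p ∣⁺ x
power-∣ {p} {a} {c} {y} (p^a≡c , cy≡x , _) = subst (value p ℕ.∣_) cy≡x
  (ℕ.∣m⇒∣m*n (value y) (subst (value p ℕ.∣_) p^a≡c (∣^ (value p) (value a) {{value-nonZero a}})))

-- Regrouping `c * (d * w)` as `d * (c * w)` makes `c * w` the new cofactor. The primes differ
-- because `q` divides `y` and `p` does not; hence `q` does not divide the power `c` of `p`.
part-of-cofactor : ∀ {p a c y x q b d w} → p ∈ Prime⁺ → q ∈ Prime⁺ →
  Part p a c y x → Part q b d w y → ¬ p ≡ q × ∃[ v ] Part q b d v x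
part-of-cofactor {p} {a} {c} {y} {x} {q} {b} {d} {w} pp pq
                 (p^a≡c , cy≡x , p∤y) part@(q^b≡d , dw≡y , q∤w) =
  p≢q , pos (value c ℕ.* value w) {{ℕ.m*n≢0 (value c) (value w) {{value-nonZero c}} {{value-nonZero w}}}} ,
  q^b≡d , trans (rearrange (value d) (value c) (value w)) (trans (cong (value c ℕ.*_) dw≡y) cy≡x) ,
  λ h → [ (λ q∣c → p≢q (sym (ℕ⁺-≡ (prime∣^⇒≡ pq pp (value a) (subst (value q ℕ.∣_) (sym p^a≡c) q∣c)))))
        , q∤w ]′ (ℕ.euclidsLemma (value c) (value w) pq h)
  where
  p≢q : ¬ p ≡ q
  p≢q refl = p∤y (power-∣ {p} {b} {d} {w} {y} part)
  rearrange : ∀ d c w → d ℕ.* (c ℕ.* w) ≡ c ℕ.* (d ℕ.* w)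
  rearrange = solve-∀

-- If the primes coincide, so do the exponents, contrary to `distinct`. If not, `q` does not divide
-- `c`, so the factor `d` of `c * y` must divide `y`.
cofactor-part : ∀ {p a c y x q b d v} → p ∈ Prime⁺ → q ∈ Prime⁺ →
  Part p a c y x → Part q b d v x → ¬ (p ≡ q × a ≡ b) → ∃[ w ] Part q b d w y
cofactor-part {p} {a} {c} {y} {x} {q} {b} {d} {v} pp pq
              (p^a≡c , cy≡x , p∤y) (q^b≡d , dv≡x , q∤v) distinct
  with value p ℕ.≟ value q
... | yes p≡q with ℕ⁺-≡ {p} {q} p≡q
...   | refl = contradiction (refl , ℕ⁺-≡ {a} {b} (exponent-unique pp (value a) (value b) p∤y q∤v
          (trans (cong (ℕ._* value y) p^a≡c)
            (trans (trans cy≡x (sym dv≡x)) (cong (ℕ._* value v) (sym q^b≡d))))))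
        distinct
cofactor-part {p} {a} {c} {pos y} {x} {q} {b} {d} {v} pp pq
              (p^a≡c , cy≡x , p∤y) (q^b≡d , dv≡x , q∤v) distinct | no p≢q
  with ^∣*⇒^∣ pq (value b) {value c} {y}
         (λ q∣c → p≢q (sym (prime∣^⇒≡ pq pp (value a) (subst (value q ℕ.∣_) (sym p^a≡c) q∣c))))
         (subst (ℕ._∣ value c ℕ.* y) (sym q^b≡d)
           (ℕ.divides (value v) (trans cy≡x (trans (sym dv≡x) (ℕ.*-comm (value d) (value v))))))
... | ℕ.divides w refl =
  pos w {{ℕ.m*n≢0⇒m≢0 w}} , q^b≡d , trans (cong (ℕ._* w) (sym q^b≡d)) (ℕ.*-comm (value q ℕ.^ value b) w) ,
  -- Cancelling `d` identifies `v` with `c * w`, so if `q` divided `w` it would divide `v`.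
  λ q∣w → q∤v (subst (value q ℕ.∣_) (ℕ.*-cancelˡ-≡ _ _ (value d) {{value-nonZero d}}
    (trans (trans (rearrange (value d) (value c) w)
      (cong (λ t → value c ℕ.* (w ℕ.* t)) (sym q^b≡d))) (trans cy≡x (sym dv≡x))))
    (ℕ.∣n⇒∣m*n (value c) q∣w))
  where
  rearrange : ∀ d c w → d ℕ.* (c ℕ.* w) ≡ c ℕ.* (w ℕ.* d)
  rearrange = solve-∀

-- Convex for every `B`, so these sets let the convex members of a basic class see the whole type of
-- the base.
powers : Pred ℕ⁺ 0ℓ → Pred ℕ⁺ 0ℓ
powers B c = ∃₂ λ p a → p ∈ B × p ∈ Prime⁺ × PowerOf p a c

powers⊆ℙᵉˣᵖ : ∀ {B c} → c ∈ powers B → c ∈ ℙᵉˣᵖ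
powers⊆ℙᵉˣᵖ (p , a , _ , pp , e) = p , a , pp , e

powers-convex : ∀ B → Convex (powers B)
powers-convex B {m} {n} {c} (p , a , p∈B , pp , p^a≡m) (q , b , q∈B , pq , q^b≡n) m∣c c∣n
  with divisor-of-prime-power pq (value b) (subst (value c ℕ.∣_) (sym q^b≡n) c∣n)
... | suc k , q^k≡c = q , pos (suc k) , q∈B , pq , q^k≡c
-- The exponent must be positive: `k = 0` gives `c = 1`, although `p` divides `m` and hence `c`.
... | zero  , 1≡c   = contradiction (ℕ.∣1⇒≡1 (subst (value p ℕ.∣_) (sym 1≡c)
                        (ℕ.∣-trans
                          (subst (value p ℕ.∣_) p^a≡m (∣^ (value p) (value a) {{value-nonZero a}})) m∣c)))
                        (prime≢1 pp)

ℙᵉˣᵖ-convex : Convex ℙᵉˣᵖ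
ℙᵉˣᵖ-convex {a} {b} {c} (p , k , pp , e) (q , l , pq , f) a∣c c∣b =
  powers⊆ℙᵉˣᵖ {U} {c} (powers-convex U {a} {b} {c} (p , k , _ , pp , e) (q , l , _ , pq , f) a∣c c∣b)

-- Recursive in the cofactor, so that a formula of fixed size relates n and suc n.
Divisors≥ : ℕ → Pred ℕ⁺ 0ℓ → Pred ℕ⁺ 0ℓ
Divisors≥ zero    A = U
Divisors≥ (suc n) A x = ∃[ p ] ∃[ a ] ∃[ c ] ∃[ y ]
  (p ∈ Prime⁺ × c ∈ A × Part p a c y x × y ∈ Divisors≥ n A)

-- Binary in `x` and `c`, so that its section at a nonstandard `x` is an internal set to which
-- saturation applies.
PartIn : Pred ℕ⁺ 0ℓ → ℕ⁺ → ℕ⁺ → Set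
PartIn A x c = ∃[ p ] ∃[ a ] ∃[ y ] (p ∈ Prime⁺ × c ∈ A × Part p a c y x)

part : ∀ {n} → Fin n → Fin n → Fin n → Fin n → Fin n → Φ n
part p a c y x = P₃ PowerOf p a c ∧ P₃ Product c y x ∧ ~ P₂ _∣⁺_ p y

-- Transferred facts about sets, powers and exact divisors.

module Star (lem : ∀ {ℓ} → ExcludedMiddle ℓ) (E : NonstandardExtension) where
  open NonstandardExtension E
  open Extension E
  open Transfer E
  open Semantics standard    using () renaming (⟦_⟧ to ⟦_⟧ˢ)
  open Semantics nonstandard using () renaming (⟦_⟧ to ⟦_⟧⋆)

  -- The set defined by `φ` is itself a symbol of the language, so its equivalence with `φ` is a
  -- sentence, trivially true in ℕ⁺.
  definable₁ : (φ : Φ 1) {x : ⋆ℕ} → x ∈⋆ (λ m → ⟦ φ ⟧ˢ (m ∷ [])) ⇔ ⟦ φ ⟧⋆ (x ∷ (ι ∘ []))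
  definable₁ φ {x} = mk⇔ (proj₁ (h x)) (proj₂ (h x))
    where
    A : Pred ℕ⁺ 0ℓ
    A m = ⟦ φ ⟧ˢ (m ∷ [])
    h : ∀ x → (x ∈⋆ A → ⟦ φ ⟧⋆ (x ∷ (ι ∘ []))) × (⟦ φ ⟧⋆ (x ∷ (ι ∘ [])) → x ∈⋆ A)
    h = to (transferᶠ (Α ((P₁ A 0F ⇒ φ) ∧ (φ ⇒ P₁ A 0F))) []) (λ _ → id , id)

  definable₂ : (φ : Φ 2) {x y : ⋆ℕ} →
    I⋆₂ (λ m n → ⟦ φ ⟧ˢ (n ∷ m ∷ [])) x y ⇔ ⟦ φ ⟧⋆ (y ∷ x ∷ (ι ∘ []))
  definable₂ φ {x} {y} = mk⇔ (proj₁ (h x y)) (proj₂ (h x y))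
    where
    R : ℕ⁺ → ℕ⁺ → Set
    R m n = ⟦ φ ⟧ˢ (n ∷ m ∷ [])
    h : ∀ x y → (I⋆₂ R x y → ⟦ φ ⟧⋆ (y ∷ x ∷ (ι ∘ []))) × (⟦ φ ⟧⋆ (y ∷ x ∷ (ι ∘ [])) → I⋆₂ R x y)
    h = to (transferᶠ (Α (Α ((P₂ R 1F 0F ⇒ φ) ∧ (φ ⇒ P₂ R 1F 0F)))) []) (λ _ _ → id , id)

  ∈⋆-mono : ∀ {A B x} → A ⊆ B → x ∈⋆ A → x ∈⋆ B
  ∈⋆-mono {A} {B} {x} A⊆B = to (transferᶠ (Α (P₁ A 0F ⇒ P₁ B 0F)) []) (λ _ → A⊆B) x

  ∈⋆-∩ : ∀ {A B x} → x ∈⋆ A → x ∈⋆ B → x ∈⋆ (A ∩ B)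
  ∈⋆-∩ {A} {B} h k = from (definable₁ (P₁ A 0F ∧ P₁ B 0F)) (h , k)

  ∈⋆-∁ : ∀ {A x} → x ∈⋆ ∁ A ⇔ (¬ x ∈⋆ A)
  ∈⋆-∁ {A} = definable₁ (~ P₁ A 0F)

  ∈⋆-U : ∀ {x} → x ∈⋆ U
  ∈⋆-U {x} = to (transferᶠ (Α (P₁ U 0F)) []) (λ _ → tt) x

  ∈⋆-satisfiable : ∀ {A x} → x ∈⋆ A → Satisfiable A
  ∈⋆-satisfiable {A} {x} h = from (transferᶠ (Ε (P₁ A 0F)) []) (x , h)

  ι-injective : ∀ {m n} → ι m ≡ ι n → m ≡ n
  ι-injective {m} {n} = from (transferᶠ (0F ≋ 1F) (m ∷ n ∷ []))

  -- An infinite `z` is at least 1 and never equals a standard number, so each standard lower bound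
  -- can be raised by one.
  ≤-infinite : ∀ {z} → Infinite z → ∀ n → ι n ⋆≤ z
  ≤-infinite {z} z∞ n = to I⋆₂-sound (to (transferᶠ (Α (P₁ (Above n) 0F ⇒ P₂ _≤⁺⁺_ 1F 0F)) (n ∷ []))
    (λ _ → id) z (above n))
    where
    _≤⁺⁺_ : ℕ⁺ → ℕ⁺ → Set
    m ≤⁺⁺ n = value m ℕ.≤ value n
    Above : ℕ⁺ → Pred ℕ⁺ 0ℓ
    Above m n = m ≤⁺⁺ n
    above-suc : ∀ k → z ∈⋆ Above (pos (suc k))
    above-suc zero    = ∈⋆-mono {U} {Above (pos 1)} (λ { {pos (suc _)} _ → ℕ.s≤s ℕ.z≤n }) ∈⋆-U
    above-suc (suc k) =
      to (transferᶠ (Α (P₁ (Above m) 0F ⇒ ~ (0F ≋ 1F) ⇒ P₁ (Above (pos (suc (suc k)))) 0F)) (m ∷ []))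
        (λ l m≤l l≢m → ℕ.≤∧≢⇒< m≤l (λ e → l≢m (ℕ⁺-≡ (sym e)))) z (above-suc k) (z∞ m)
      where
      m : ℕ⁺
      m = pos (suc k)
    above : ∀ n → z ∈⋆ Above n
    above (pos zero {{()}})
    above (pos (suc k)) = above-suc k

  Part⋆ : ⋆ℕ → ⋆ℕ → ⋆ℕ → ⋆ℕ → ⋆ℕ → Set
  Part⋆ p a c y x = I⋆₃ PowerOf p a c × I⋆₃ Product c y x × ¬ I⋆₂ _∣⁺_ p y

  power-exists⋆ : ∀ p a → ∃[ c ] IsPower p a c
  power-exists⋆ p a =
    let (c , h) = to (transferᶠ (Α (Α (Ε (P₃ PowerOf 2F 1F 0F)))) []) power-exists p a in
    c , to I⋆₃-sound h

  power-functional⋆ : ∀ p a c d → IsPower p a c → IsPower p a d → c ≡ d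
  power-functional⋆ p a c d h k = to (transferᶠ (Α (Α (Α (Α
    (P₃ PowerOf 3F 2F 1F ⇒ P₃ PowerOf 3F 2F 0F ⇒ 1F ≋ 0F))))) [])
    (λ p a c d p^a≡c p^a≡d → ℕ⁺-≡ (trans (sym p^a≡c) p^a≡d))
    p a c d (from I⋆₃-sound h) (from I⋆₃-sound k)

  prime-power-unique⋆ : ∀ p a q b c → p ∈⋆ Prime⁺ → q ∈⋆ Prime⁺ →
                        I⋆₃ PowerOf p a c → I⋆₃ PowerOf q b c →
                        p ≡ q × a ≡ b
  prime-power-unique⋆ = to (transferᶠ (Α (Α (Α (Α (Α
    (P₁ Prime⁺ 4F ⇒ P₁ Prime⁺ 2F ⇒ P₃ PowerOf 4F 3F 0F ⇒ P₃ PowerOf 2F 1F 0F ⇒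
     4F ≋ 2F ∧ 3F ≋ 1F)))))) [])
    λ p a q b c → prime-power-unique {p} {a} {q} {b} {c}

  part-of-cofactor⋆ : ∀ p a c y x q b d w → p ∈⋆ Prime⁺ → q ∈⋆ Prime⁺ →
    Part⋆ p a c y x → Part⋆ q b d w y → ¬ p ≡ q × ∃[ v ] Part⋆ q b d v x
  part-of-cofactor⋆ = to (transferᶠ (Α (Α (Α (Α (Α (Α (Α (Α (Α
    (P₁ Prime⁺ 8F ⇒ P₁ Prime⁺ 3F ⇒ part 8F 7F 6F 5F 4F ⇒ part 3F 2F 1F 0F 5F ⇒
     ~ (8F ≋ 3F) ∧ Ε (part 4F 3F 2F 0F 5F))))))))))) [])
    λ p a c y x q b d w → part-of-cofactor {p} {a} {c} {y} {x} {q} {b} {d} {w}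

  cofactor-part⋆ : ∀ p a c y x q b d v → p ∈⋆ Prime⁺ → q ∈⋆ Prime⁺ →
    Part⋆ p a c y x → Part⋆ q b d v x → ¬ (p ≡ q × a ≡ b) → ∃[ w ] Part⋆ q b d w y
  cofactor-part⋆ = to (transferᶠ (Α (Α (Α (Α (Α (Α (Α (Α (Α
    (P₁ Prime⁺ 8F ⇒ P₁ Prime⁺ 3F ⇒ part 8F 7F 6F 5F 4F ⇒ part 3F 2F 1F 0F 4F ⇒
     ~ (8F ≋ 3F ∧ 7F ≋ 2F) ⇒ Ε (part 4F 3F 2F 0F 6F))))))))))) [])
    λ p a c y x q b d v → cofactor-part {p} {a} {c} {y} {x} {q} {b} {d} {v}

  divisors≥-suc⋆ : ∀ n A {x} → x ∈⋆ Divisors≥ (suc n) A ⇔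
    (∃[ p ] ∃[ a ] ∃[ c ] ∃[ y ] (p ∈⋆ Prime⁺ × c ∈⋆ A × Part⋆ p a c y x × y ∈⋆ Divisors≥ n A))
  divisors≥-suc⋆ n A = definable₁ (Ε (Ε (Ε (Ε
    (P₁ Prime⁺ 3F ∧ P₁ A 1F ∧ part 3F 2F 1F 0F 4F ∧ P₁ (Divisors≥ n A) 0F)))))

  partIn⋆ : ∀ A {x c} → I⋆₂ (PartIn A) x c ⇔
    (∃[ p ] ∃[ a ] ∃[ y ] (p ∈⋆ Prime⁺ × c ∈⋆ A × Part⋆ p a c y x))
  partIn⋆ A = definable₂ (Ε (Ε (Ε
    (P₁ Prime⁺ 2F ∧ P₁ A 3F ∧ part 2F 1F 3F 0F 4F))))

  powers⋆ : ∀ B p a c → p ∈⋆ Prime⁺ → IsPower p a c → (p ∈⋆ B ⇔ c ∈⋆ powers B)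
  powers⋆ B p a c pp p^a≡c =
    mk⇔ (λ p∈B → from definition (p , a , p∈B , pp , from I⋆₃-sound p^a≡c)) λ c∈ → backward (to definition c∈)
    where
    definition : c ∈⋆ powers B ⇔ (∃[ p ] ∃[ a ] (p ∈⋆ B × p ∈⋆ Prime⁺ × I⋆₃ PowerOf p a c))
    definition = definable₁ (Ε (Ε (P₁ B 1F ∧ P₁ Prime⁺ 1F ∧ P₃ PowerOf 1F 0F 2F)))
    backward : (∃[ q ] ∃[ b ] (q ∈⋆ B × q ∈⋆ Prime⁺ × I⋆₃ PowerOf q b c)) → p ∈⋆ B
    backward (q , b , q∈B , pq , q^b≡c) =
      subst (_∈⋆ B) (proj₁ (prime-power-unique⋆ q b p a c pq pp q^b≡c (from I⋆₃-sound p^a≡c))) q∈B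

  -- Basic classes and their convex members.

  open BasicClass

  tp^ᴮ : BasicClass → Pred (Pred ℕ⁺ 0ℓ) 0ℓ
  tp^ᴮ v = tp^ (base v) (exponent v)

  tp^⇔∈⋆ : ∀ A {p a c} → IsPower p a c → A ∈ tp^ p a ⇔ c ∈⋆ A
  tp^⇔∈⋆ A {p} {a} {c} p^a≡c = mk⇔
    (λ (d , p^a≡d , d∈A) → subst (_∈⋆ A) (power-functional⋆ p a d c p^a≡d p^a≡c) d∈A)
    (λ c∈A → c , p^a≡c , c∈A)

  tp^-mono : ∀ {A B} v → A ⊆ B → A ∈ tp^ᴮ v → B ∈ tp^ᴮ v
  tp^-mono {A} {B} v A⊆B (c , p^a≡c , c∈A) = c , p^a≡c , ∈⋆-mono {A} {B} {c} A⊆B c∈A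

  tp^-∩ : ∀ {A B} v → A ∈ tp^ᴮ v → B ∈ tp^ᴮ v → (A ∩ B) ∈ tp^ᴮ v
  tp^-∩ {A} {B} v (c , p^a≡c , c∈A) B∈ =
    c , p^a≡c , ∈⋆-∩ {A} {B} {c} c∈A (to (tp^⇔∈⋆ B p^a≡c) B∈)

  tp^-∁ : ∀ {A} v → ∁ A ∈ tp^ᴮ v ⇔ (A ∉ tp^ᴮ v)
  tp^-∁ {A} v = let (c , p^a≡c) = power-exists⋆ (base v) (exponent v) in mk⇔
    (λ ∁A∈ A∈ → to (∈⋆-∁ {A} {c}) (to (tp^⇔∈⋆ (∁ A) p^a≡c) ∁A∈) (to (tp^⇔∈⋆ A p^a≡c) A∈))
    (λ A∉ → c , p^a≡c , from (∈⋆-∁ {A} {c}) (λ c∈A → A∉ (c , p^a≡c , c∈A)))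

  tp^-satisfiable : ∀ {A} v → A ∈ tp^ᴮ v → Satisfiable A
  tp^-satisfiable {A} v (c , _ , c∈A) = ∈⋆-satisfiable {A} {c} c∈A

  tp^-powers : ∀ {B} v → base v ∈⋆ B ⇔ powers B ∈ tp^ᴮ v
  tp^-powers {B} v = mk⇔
    (λ p∈B → let (c , p^a≡c) = power-exists⋆ (base v) (exponent v) in
      c , p^a≡c , to (powers⋆ B (base v) (exponent v) c (base-prime v) p^a≡c) p∈B)
    (λ (c , p^a≡c , c∈) → from (powers⋆ B (base v) (exponent v) c (base-prime v) p^a≡c) c∈)

  tp^-ℙᵉˣᵖ : ∀ v → ℙᵉˣᵖ ∈ tp^ᴮ v
  tp^-ℙᵉˣᵖ v = tp^-mono {powers U} {ℙᵉˣᵖ} v (λ {c} → powers⊆ℙᵉˣᵖ {U} {c})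
    (to (tp^-powers {U} v) (∈⋆-U {base v}))

  ∁-𝓤-↓ : ∀ {A m n} → A ∈ 𝓤 → m ∣⁺ n → n ∉ A → m ∉ A
  ∁-𝓤-↓ {A} {m} (_ , _ , A↑⊆A) m∣n n∉A m∈A = n∉A (A↑⊆A (m , m∈A , m∣n))

  -- A convex set is the difference of the up-closed sets A ↑ and A ↑ ∩ ∁ A.
  convex-∈ᴮ : ∀ {A} v → A ∈ 𝓒 → A ∈ tp^ᴮ v → A ∈ᴮ v
  convex-∈ᴮ {A} v (sat , _ , convex) A∈v w (_ , w→v , v→w) = decidable-stable lem λ A∉w →
    to (tp^-∁ {A} v) (tp^-mono {B} {∁ A} v proj₂ (w→v {B} (B∈w A∉w , B∈𝓤 A∉w))) A∈v
    where
    A⊆A↑ : A ⊆ A ↑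
    A⊆A↑ {a} a∈A = a , a∈A , ℕ.∣-refl
    A↑∈𝓤 : A ↑ ∈ 𝓤
    A↑∈𝓤 = (proj₁ sat , A⊆A↑ (proj₂ sat)) ,
      (λ {n} h → n , h , ℕ.∣-refl) , λ { (m , (a , a∈A , a∣m) , m∣n) → a , a∈A , ℕ.∣-trans a∣m m∣n }
    B : Pred ℕ⁺ 0ℓ
    B = A ↑ ∩ ∁ A
    B∈w : A ∉ tp^ᴮ w → B ∈ tp^ᴮ w
    B∈w A∉w = tp^-∩ {A ↑} {∁ A} w (v→w {A ↑} (tp^-mono {A} {A ↑} v A⊆A↑ A∈v , A↑∈𝓤))
      (from (tp^-∁ {A} w) A∉w)
    -- `B` is nonempty because it belongs to the type at `w`, and up-closed by convexity: a multiple
    -- of `m` lying in `A` would enclose `m` between two elements of `A`.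
    B∈𝓤 : A ∉ tp^ᴮ w → B ∈ 𝓤
    B∈𝓤 A∉w = tp^-satisfiable {B} w (B∈w A∉w) ,
      (λ {n} h → n , h , ℕ.∣-refl) ,
      λ {n} → λ { (m , ((a , a∈A , a∣m) , m∉A) , m∣n) →
        (a , a∈A , ℕ.∣-trans a∣m m∣n) , λ n∈A → m∉A (convex a∈A n∈A a∣m m∣n) }

  ∩-𝓒 : ∀ {A B} v → A ∈ 𝓒 → B ∈ 𝓒 → A ∈ tp^ᴮ v → B ∈ tp^ᴮ v → (A ∩ B) ∈ 𝓒
  ∩-𝓒 {A} {B} v (_ , A⊆ , A-convex) (_ , _ , B-convex) A∈ B∈ =
    tp^-satisfiable {A ∩ B} v (tp^-∩ {A} {B} v A∈ B∈) , (A⊆ ∘ proj₁) ,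
    λ (h , h′) (k , k′) p q → A-convex h k p q , B-convex h′ k′ p q

  powers-𝓒 : ∀ {B} v → powers B ∈ tp^ᴮ v → powers B ∈ 𝓒
  powers-𝓒 {B} v h = tp^-satisfiable {powers B} v h , (λ {c} → powers⊆ℙᵉˣᵖ {B} {c}) ,
    λ {a} {b} {c} → powers-convex B {a} {b} {c}

  ℙᵉˣᵖ-𝓒 : BasicClass → ℙᵉˣᵖ ∈ 𝓒
  ℙᵉˣᵖ-𝓒 v = tp^-satisfiable {ℙᵉˣᵖ} v (tp^-ℙᵉˣᵖ v) , (λ c∈ℙ → c∈ℙ) ,
    λ {a} {b} {c} → ℙᵉˣᵖ-convex {a} {b} {c}

  -- One inclusion suffices. The sets `powers B` carry over the type of the base. For `A ∈ 𝓤`, both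
  -- `A` and its complement meet `ℙᵉˣᵖ` in a convex set, the complement being closed under divisors;
  -- these give the two directions of `=~`.
  convex-≈ᴮ : ∀ u v → (∀ A → A ∈ 𝓒 → A ∈ tp^ᴮ u → A ∈ tp^ᴮ v) → v ≈ᴮ u
  convex-≈ᴮ u v h = (tp-⊆ , ⊆-tp) , v→u , u→v
    where
    ⊆-tp : tp (base u) ⊆ tp (base v)
    ⊆-tp {B} p∈B = let k = to (tp^-powers {B} u) p∈B in
      from (tp^-powers {B} v) (h (powers B) (powers-𝓒 {B} u k) k)
    tp-⊆ : tp (base v) ⊆ tp (base u)
    tp-⊆ {B} q∈B = decidable-stable lem λ p∉B →
      to (∈⋆-∁ {B} {base v}) (⊆-tp {∁ B} (from (∈⋆-∁ {B} {base u}) p∉B)) q∈B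
    u→v : tp^ᴮ u ∣~ tp^ᴮ v
    u→v {A} (A∈u , A∈𝓤) = tp^-mono {A ∩ ℙᵉˣᵖ} {A} v proj₁ (h (A ∩ ℙᵉˣᵖ) A∩ℙ∈𝓒 A∩ℙ∈u)
      where
      A∩ℙ∈u = tp^-∩ {A} {ℙᵉˣᵖ} u A∈u (tp^-ℙᵉˣᵖ u)
      A∩ℙ∈𝓒 : (A ∩ ℙᵉˣᵖ) ∈ 𝓒
      A∩ℙ∈𝓒 = tp^-satisfiable {A ∩ ℙᵉˣᵖ} u A∩ℙ∈u , proj₂ , λ {a} {b} {c} (a∈A , a∈ℙ) (_ , b∈ℙ) a∣c c∣b →
        proj₂ (proj₂ A∈𝓤) (a , a∈A , a∣c) , ℙᵉˣᵖ-convex {a} {b} {c} a∈ℙ b∈ℙ a∣c c∣b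
    v→u : tp^ᴮ v ∣~ tp^ᴮ u
    v→u {A} (A∈v , A∈𝓤) = decidable-stable lem λ A∉u →
      let ∁A∩ℙ∈u = tp^-∩ {∁ A} {ℙᵉˣᵖ} u (from (tp^-∁ {A} u) A∉u) (tp^-ℙᵉˣᵖ u) in
      to (tp^-∁ {A} v) (tp^-mono {∁ A ∩ ℙᵉˣᵖ} {∁ A} v proj₁ (h (∁ A ∩ ℙᵉˣᵖ) (∁A∩ℙ∈𝓒 ∁A∩ℙ∈u) ∁A∩ℙ∈u)) A∈v
      where
      ∁A∩ℙ∈𝓒 : (∁ A ∩ ℙᵉˣᵖ) ∈ tp^ᴮ u → (∁ A ∩ ℙᵉˣᵖ) ∈ 𝓒
      ∁A∩ℙ∈𝓒 ∁A∩ℙ∈u = tp^-satisfiable {∁ A ∩ ℙᵉˣᵖ} u ∁A∩ℙ∈u , proj₂ ,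
        λ {a} {b} {c} (_ , a∈ℙ) (b∉A , b∈ℙ) a∣c c∣b →
        ∁-𝓤-↓ {A} {c} {b} A∈𝓤 c∣b b∉A , ℙᵉˣᵖ-convex {a} {b} {c} a∈ℙ b∈ℙ a∣c c∣b

-- Comparing cardinalities, and limits in ℕ∞.

AtLeast : ∀ {a ℓ} → ℕ → Setoid a ℓ → Set (a ⊔ ℓ)
AtLeast n S = Σ[ f ∈ (Fin n → Carrier) ] (∀ i j → f i ≈ f j → i ≡ j)
  where open Setoid S

AtLeast-bijection : ∀ {a b ℓ ℓ′} {S : Setoid a ℓ} {T : Setoid b ℓ′} → Bijection S T →
                    ∀ n → AtLeast n S ⇔ AtLeast n T
AtLeast-bijection {S = S} {T} β n = mk⇔
  (λ (f , f-inj) → β.to ∘ f , λ i j e → f-inj i j (β.injective {f i} {f j} e))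
  (λ (g , g-inj) → (λ i → proj₁ (preimage (g i))) , λ i j e →
    g-inj i j (T.trans {g i} {β.to (proj₁ (preimage (g i)))} {g j}
      (T.sym {β.to (proj₁ (preimage (g i)))} {g i} (proj₂ (preimage (g i))))
      (T.trans {β.to (proj₁ (preimage (g i)))} {β.to (proj₁ (preimage (g j)))} {g j}
        (β.cong {proj₁ (preimage (g i))} {proj₁ (preimage (g j))} e)
        (proj₂ (preimage (g j))))))
  where
  module β = Bijection β
  module T = Setoid T
  preimage : ∀ y → ∃[ x ] β.to x T.≈ y
  preimage = β.strictlySurjective

-- Natural lower bounds determine an element of ℕ∞, so comparisons of cardinalities reduce to
-- `AtLeast`.
≤⁺-from-below : ∀ k l → (∀ n → [ n ] ≤⁺ k → [ n ] ≤⁺ l) → k ≤⁺ l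
≤⁺-from-below k     ∞     h = k ≤⊤⁺
≤⁺-from-below [ m ] [ l ] h = h m [ ℕ.≤-refl ]
≤⁺-from-below ∞     [ l ] h with h (suc l) (_ ≤⊤⁺)
... | [ l<l ] = contradiction l<l ℕ.1+n≰n

≤⁺-≢⇒suc≤⁺ : ∀ {n} {k : ℕ∞} → [ n ] ≤⁺ k → ¬ k ≡ [ n ] → [ suc n ] ≤⁺ k
≤⁺-≢⇒suc≤⁺ {k = ∞}     _     _   = _ ≤⊤⁺
≤⁺-≢⇒suc≤⁺ {k = [ m ]} [ p ] k≢n = [ ℕ.≤∧≢⇒< p (λ { refl → k≢n refl }) ]

bound : (ns : List ℕ) → ∃[ N ] (∀ {n} → n ∈ₗ ns → n ℕ.< N)
bound List.[]       = 0 , λ ()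
bound (n List.∷ ns) = let (N , h) = bound ns in suc n ℕ.⊔ N , λ
  { (here refl)  → ℕ.m≤m⊔n (suc n) N
  ; (there n∈ns) → ℕ.≤-trans (h n∈ns) (ℕ.m≤n⊔m (suc n) N) }

module Classical (lem : ∀ {ℓ} → ExcludedMiddle ℓ) where

  last-holding : ∀ {ℓ} (P : ℕ → Set ℓ) → P 0 → ∀ n → ¬ P n → ∃[ m ] (P m × ¬ P (suc m))
  last-holding P p₀ zero    ¬p = contradiction p₀ ¬p
  last-holding P p₀ (suc n) ¬p with lem {P = P n}
  ... | yes pₙ = n , pₙ , ¬p
  ... | no ¬pₙ = last-holding P p₀ n ¬pₙ

  -- The limit is ∞ if every level set `Above n` is ℋ-large, and otherwise an `m` at which largeness
  -- stops. The last component locates the limit through these level sets, which is the form that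
  -- counting uses.
  limit-exists : ∀ {i} {I : Set i} (H : Ultrafilter I) (x : I → ℕ∞) →
    ∃[ l ] (HLim H x l × (∀ n → [ n ] ≤⁺ l ⇔ (λ j → [ n ] ≤⁺ x j) ∈ member H))
  limit-exists {I = I} H x = go lem
    where
    module H = Ultrafilter H
    Above : ℕ → Pred I 0ℓ
    Above n j = [ n ] ≤⁺ x j
    go : Dec (∀ n → Above n ∈ member H) →
         ∃[ l ] (HLim H x l × (∀ n → [ n ] ≤⁺ l ⇔ Above n ∈ member H))
    go (yes all) = ∞ ,
      (λ D (O , O-open , ∞∈O , O⊆D) →
        -- An open set around ∞ misses only finitely many numbers, so it contains everything from
        -- some `N` on.
        let (ns , cofinite) = O-open ∞∈O
            (N , below) = bound ns
            inside : ∀ k → [ N ] ≤⁺ k → k ∈ O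
            inside = λ { ∞ _ → ∞∈O
                       ; [ m ] → λ { [ N≤m ] → decidable-stable lem λ m∉O →
                           ℕ.<⇒≱ (below (cofinite m m∉O)) N≤m } }
        in H.upward (λ {j} h → O⊆D (inside (x j) h)) (all N)) ,
      λ n → mk⇔ (λ _ → all n) (λ _ → _ ≤⊤⁺)
    go (no ¬all) =
      let (n , ¬n) = decidable-stable (lem {P = ∃[ n ] ¬ (Above n ∈ member H)})
                       (λ h → ¬all λ n → decidable-stable lem λ ¬n → h (n , ¬n))
          (m , yes-m , no-m) = last-holding (λ n → Above n ∈ member H)
                                 (H.upward (λ {j} _ → zero-below (x j)) H.full) n ¬n
      in [ m ] ,
        -- Level `m` is large and level `suc m` is not, so `x j = m` for ℋ-almost all `j`.
        (λ D (O , _ , m∈O , O⊆D) → H.upward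
          (λ {j} (h , k) → O⊆D (subst O (sym (decidable-stable lem λ x≢m → k (≤⁺-≢⇒suc≤⁺ h x≢m))) m∈O))
          (H.meet yes-m (not-member no-m))) ,
        λ n → mk⇔
          (λ { [ n≤m ] → H.upward (λ {j} → ≤⁺-trans ℕ.≤-trans [ n≤m ]) yes-m })
          (λ h → decidable-stable lem λ n≰m → no-m
            (H.upward (λ {j} → ≤⁺-trans ℕ.≤-trans [ ℕ.≰⇒> (n≰m ∘ [_]) ]) h))
      where
      zero-below : ∀ k → [ 0 ] ≤⁺ k
      zero-below ∞     = _ ≤⊤⁺
      zero-below [ n ] = [ ℕ.z≤n ]
      not-member : ∀ {A} → A ∉ member H → ∁ A ∈ member H
      not-member {A} A∉ with H.ultra A
      ... | inj₁ A∈  = contradiction A∈ A∉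
      ... | inj₂ ∁A∈ = ∁A∈

  -- Replaces `≈` by equality of indices among finitely many elements. The bijections of a pattern
  -- belong to representatives rather than to classes, so equivalent classes must be read through
  -- one common representative.
  representatives : ∀ {a ℓ} (S : Setoid a ℓ) → let open Setoid S in ∀ {n} (v : Fin n → Carrier) →
    Σ[ r ∈ (Fin n → Fin n) ] ((∀ i → v (r i) ≈ v i) × (∀ i j → v i ≈ v j → r i ≡ r j))
  representatives S {zero}  v = (λ ()) , (λ ()) , (λ ())
  representatives S {suc n} v = r , r-≈ , r-≡
    where
    open Setoid S renaming (refl to ≈-refl; sym to ≈-sym; trans to ≈-trans)
    IH = representatives S (v ∘ suc)
    r′ = proj₁ IH
    choose : ∀ i → Dec (v zero ≈ v (suc i)) → Fin (suc n)
    choose i (yes _) = zero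
    choose i (no _)  = suc (r′ i)
    r : Fin (suc n) → Fin (suc n)
    r zero    = zero
    r (suc i) = choose i lem
    choose-≈ : ∀ i d → v (choose i d) ≈ v (suc i)
    choose-≈ i (yes e) = e
    choose-≈ i (no _)  = proj₁ (proj₂ IH) i
    r-≈ : ∀ i → v (r i) ≈ v i
    r-≈ zero    = ≈-refl {v zero}
    r-≈ (suc i) = choose-≈ i lem
    choose-≡ : ∀ i j d d′ → v (suc i) ≈ v (suc j) → choose i d ≡ choose j d′
    choose-≡ i j (yes _)  (yes _)  _ = refl
    choose-≡ i j (yes e)  (no ¬e′) h = contradiction (≈-trans {v zero} {v (suc i)} {v (suc j)} e h) ¬e′
    choose-≡ i j (no ¬e)  (yes e′) h =
      contradiction (≈-trans {v zero} {v (suc j)} {v (suc i)} e′ (≈-sym {v (suc i)} {v (suc j)} h)) ¬e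
    choose-≡ i j (no _)   (no _)   h = cong suc (proj₂ (proj₂ IH) i j h)
    zero-≡ : ∀ i d → v zero ≈ v (suc i) → zero ≡ choose i d
    zero-≡ i (yes _) _ = refl
    zero-≡ i (no ¬e) e = contradiction e ¬e
    r-≡ : ∀ i j → v i ≈ v j → r i ≡ r j
    r-≡ zero    zero    _ = refl
    r-≡ zero    (suc j) e = zero-≡ j lem e
    r-≡ (suc i) zero    e = sym (zero-≡ i lem (≈-sym {v (suc i)} {v zero} e))
    r-≡ (suc i) (suc j) e = choose-≡ i j lem lem e

-- Counting the exact divisors of a nonstandard number that lie in a set.

module Patterns (lem : ∀ {ℓ} → ExcludedMiddle ℓ) (E : NonstandardExtension) where
  open NonstandardExtension E
  open Extension E
  open Transfer E
  open Sections using (section-internal)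
  open Star lem E
  open Classical lem
  open BasicClass

  pair : BasicClass → ⋆ℕ × ⋆ℕ
  pair v = base v , exponent v

  pair-≈ᴮ : ∀ {v w} → pair v ≡ pair w → v ≈ᴮ w
  pair-≈ᴮ {v} {w} refl = Setoid.refl 𝓑 {v}

  _∥_ : BasicClass → ⋆ℕ → Set
  v ∥ x = ExactlyDivides (base v) (exponent v) x

  DivisorsIn : Pred ℕ⁺ 0ℓ → ⋆ℕ → Setoid 0ℓ 0ℓ
  DivisorsIn A x = On.setoid {B = ∃[ v ] (A ∈ tp^ᴮ v × v ∥ x)} (setoid (⋆ℕ × ⋆ℕ)) (pair ∘ proj₁)

  ∥⇔Part⋆ : ∀ {v x} → v ∥ x ⇔ ∃₂ λ c y → Part⋆ (base v) (exponent v) c y x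
  ∥⇔Part⋆ = mk⇔
    (λ (c , y , h , k , n) → c , y , from I⋆₃-sound h , from I⋆₃-sound k , λ d → n (to I⋆₂-sound d))
    (λ (c , y , h , k , n) → c , y , to I⋆₃-sound h , to I⋆₃-sound k , λ d → n (from I⋆₂-sound d))

  ∥-cofactor : ∀ {v w c y x} → Part⋆ (base v) (exponent v) c y x → w ∥ x → ¬ pair w ≡ pair v → w ∥ y
  ∥-cofactor {v} {w} {c} {y} {x} part w∥x w≢v =
    let (d , u , part′) = to (∥⇔Part⋆ {w}) w∥x
        (t , part″) = cofactor-part⋆ (base v) (exponent v) c y x (base w) (exponent w) d u
                        (base-prime v) (base-prime w) part part′
                        (λ (p , q) → w≢v (sym (cong₂ _,_ p q)))
    in from (∥⇔Part⋆ {w}) (d , t , part″)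

  cofactor-∥ : ∀ {v w c y x} → Part⋆ (base v) (exponent v) c y x → w ∥ y → w ∥ x × ¬ pair w ≡ pair v
  cofactor-∥ {v} {w} {c} {y} {x} part w∥y =
    let (d , t , part′) = to (∥⇔Part⋆ {w}) w∥y
        (p≢q , u , part″) = part-of-cofactor⋆ (base v) (exponent v) c y x (base w) (exponent w) d t
                              (base-prime v) (base-prime w) part part′
    in from (∥⇔Part⋆ {w}) (d , u , part″) , λ e → p≢q (sym (cong proj₁ e))

  -- At most one of the listed divisors is `v`, and the others survive the division. If none is `v`,
  -- the first is dropped to keep the count.
  remove : ∀ {v c y x} → Part⋆ (base v) (exponent v) c y x → ∀ A m →
           AtLeast (suc m) (DivisorsIn A x) → AtLeast m (DivisorsIn A y)
  remove {v} {c} {y} {x} part A m (f , f-inj) = go lem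
    where
    strip : ∀ i → ¬ pair (proj₁ (f i)) ≡ pair v → Setoid.Carrier (DivisorsIn A y)
    strip i ≢v = proj₁ (f i) , proj₁ (proj₂ (f i)) ,
      ∥-cofactor {v} {proj₁ (f i)} part (proj₂ (proj₂ (f i))) ≢v
    go : Dec (∃[ i ] pair (proj₁ (f i)) ≡ pair v) → AtLeast m (DivisorsIn A y)
    go (yes (i , fᵢ≡v)) =
      (λ j → strip (punchIn i j) (λ e → punchInᵢ≢i i j (f-inj (punchIn i j) i (trans e (sym fᵢ≡v))))) ,
      λ j k e → punchIn-injective i j k (f-inj (punchIn i j) (punchIn i k) e)
    go (no v∉f) = (λ j → strip (suc j) (λ e → v∉f (suc j , e))) ,
      λ j k e → suc-injective (f-inj (suc j) (suc k) e)

  -- Induction along cofactors: forwards the first divisor is divided out, backwards it is put in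
  -- front of the divisors of `y`, all of which have another base.
  divisors≥ : ∀ n A x → AtLeast n (DivisorsIn A x) ⇔ x ∈⋆ Divisors≥ n A
  divisors≥ zero    A x = mk⇔ (λ _ → ∈⋆-U {x}) (λ _ → (λ ()) , λ ())
  divisors≥ (suc n) A x = mk⇔ forward backward
    where
    forward : AtLeast (suc n) (DivisorsIn A x) → x ∈⋆ Divisors≥ (suc n) A
    forward many@(f , _) =
      let v = proj₁ (f zero)
          (c , y , part) = to (∥⇔Part⋆ {v}) (proj₂ (proj₂ (f zero)))
      in from (divisors≥-suc⋆ n A) (base v , exponent v , c , y , base-prime v ,
           to (tp^⇔∈⋆ A (to I⋆₃-sound (proj₁ part))) (proj₁ (proj₂ (f zero))) , part ,
           to (divisors≥ n A y) (remove {v} part A n many))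
    backward : x ∈⋆ Divisors≥ (suc n) A → AtLeast (suc n) (DivisorsIn A x)
    backward x∈ = f , f-inj
      where
      unfolded = to (divisors≥-suc⋆ n A) x∈
      p = proj₁ unfolded
      a = proj₁ (proj₂ unfolded)
      c = proj₁ (proj₂ (proj₂ unfolded))
      y = proj₁ (proj₂ (proj₂ (proj₂ unfolded)))
      rest = proj₂ (proj₂ (proj₂ (proj₂ unfolded)))
      part′ = proj₁ (proj₂ (proj₂ rest))
      v : BasicClass
      v = record { base = p ; exponent = a ; base-prime = proj₁ rest }
      IH : AtLeast n (DivisorsIn A y)
      IH = from (divisors≥ n A y) (proj₂ (proj₂ (proj₂ rest)))
      f : Fin (suc n) → Setoid.Carrier (DivisorsIn A x)
      f zero    = v , from (tp^⇔∈⋆ A (to I⋆₃-sound (proj₁ part′))) (proj₁ (proj₂ rest)) ,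
                  from (∥⇔Part⋆ {v}) (c , y , part′)
      f (suc i) = proj₁ (proj₁ IH i) , proj₁ (proj₂ (proj₁ IH i)) ,
                  proj₁ (cofactor-∥ {v} {proj₁ (proj₁ IH i)} part′ (proj₂ (proj₂ (proj₁ IH i))))
      f≢v : ∀ i → ¬ pair (proj₁ (f (suc i))) ≡ pair v
      f≢v i = proj₂ (cofactor-∥ {v} {proj₁ (proj₁ IH i)} part′ (proj₂ (proj₂ (proj₁ IH i))))
      f-inj : ∀ i j → pair (proj₁ (f i)) ≡ pair (proj₁ (f j)) → i ≡ j
      f-inj zero    zero    _ = refl
      f-inj zero    (suc j) e = contradiction (sym e) (f≢v j)
      f-inj (suc i) zero    e = contradiction e (f≢v i)
      f-inj (suc i) (suc j) e = cong suc (proj₂ IH i j e)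

  -- Dividing out one divisor costs every `A` at most one, and the same `y` serves all `A` at once,
  -- as saturation requires.
  divide-out : ∀ n x (d : Fin n → BasicClass) → (∀ i j → pair (d i) ≡ pair (d j) → i ≡ j) →
    (∀ i → d i ∥ x) →
    ∃[ y ] ((∀ v → v ∥ y → v ∥ x × (∀ i → ¬ pair v ≡ pair (d i))) ×
            (∀ A m → AtLeast (n ℕ.+ m) (DivisorsIn A x) → AtLeast m (DivisorsIn A y)))
  divide-out zero    x d d-inj d∥x = x , (λ v v∥x → v∥x , λ ()) , λ A m h → h
  divide-out (suc n) x d d-inj d∥x =
    let (c , x₁ , part) = to (∥⇔Part⋆ {d zero}) (d∥x zero)
        (y , other , many) = divide-out n x₁ (d ∘ suc) (λ i j e → suc-injective (d-inj (suc i) (suc j) e))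
          (λ i → ∥-cofactor {d zero} {d (suc i)} part (d∥x (suc i))
                   (λ e → contradiction (d-inj (suc i) zero e) λ ()))
    in y ,
      (λ v v∥y → let (v∥x₁ , v≢) = other v v∥y ; (v∥x , v≢₀) = cofactor-∥ {d zero} {v} part v∥x₁ in
        v∥x , λ { zero → v≢₀ ; (suc i) → v≢ i }) ,
      λ A m h → many A m (remove {d zero} part A (n ℕ.+ m) h)

  -- Saturation over the convex members of a basic class.

  code : (ℕ → Bool) → Pred ℕ⁺ 0ℓ
  code f m = f (value m) ≡ true

  -- Saturation is indexed by `ℕ → Bool`, so a subset of ℕ⁺ is coded by its characteristic function,
  -- which excluded middle makes available.
  encode : Pred ℕ⁺ 0ℓ → ℕ → Bool
  encode A m = Dec.does (lem {P = ∃[ k ] (k ∈ A × value k ≡ m)})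

  code-encode : ∀ A → code (encode A) ≐ A
  code-encode A = (λ {m} → forward m) , (λ {m} → backward m)
    where
    forward : ∀ m → m ∈ code (encode A) → m ∈ A
    forward m h with lem {P = ∃[ k ] (k ∈ A × value k ≡ value m)}
    ... | yes (k , k∈A , k≡m) = subst A (ℕ⁺-≡ k≡m) k∈A
    forward m () | no _
    backward : ∀ m → m ∈ A → m ∈ code (encode A)
    backward m m∈A with lem {P = ∃[ k ] (k ∈ A × value k ≡ value m)}
    ... | yes _ = refl
    ... | no ¬h = contradiction (m , m∈A , refl) ¬h

  𝓒-resp-≐ : ∀ {A B} → A ≐ B → A ∈ 𝓒 → B ∈ 𝓒
  𝓒-resp-≐ (A⊆B , B⊆A) ((a , a∈A) , A⊆ℙ , convex) =
    (a , A⊆B a∈A) , (A⊆ℙ ∘ B⊆A) , λ a∈B b∈B p q → A⊆B (convex (B⊆A a∈B) (B⊆A b∈B) p q)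

  module Saturated (saturated : 𝔠⁺-Saturated) (u : BasicClass) where

    ConvexMember : Pred (Pred ℕ⁺ 0ℓ) 0ℓ
    ConvexMember A = A ∈ 𝓒 × A ∈ tp^ᴮ u

    select : ∀ A → Dec (ConvexMember A) → ∃ ConvexMember
    select A (yes h) = A , h
    -- A default for codes of sets that are not convex members: `ℙᵉˣᵖ` is a convex member in any
    -- case.
    select A (no _)  = ℙᵉˣᵖ , ℙᵉˣᵖ-𝓒 u , tp^-ℙᵉˣᵖ u

    select-⊆ : ∀ A d → ConvexMember A → proj₁ (select A d) ⊆ A
    select-⊆ A (yes _) _ = id
    select-⊆ A (no ¬h) h = contradiction h ¬h

    family : (ℕ → Bool) → Pred ℕ⁺ 0ℓ
    family f = proj₁ (select (code f) lem)

    family-member : ∀ f → ConvexMember (family f)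
    family-member f = proj₂ (select (code f) lem)

    -- Convex members are closed under intersection, so finitely many conditions reduce to a single
    -- `B` to which the hypothesis of `realise` applies.
    common : (fs : List (ℕ → Bool)) → ∃[ B ] (ConvexMember B × All (λ f → B ⊆ family f) fs)
    common List.[]       = ℙᵉˣᵖ , (ℙᵉˣᵖ-𝓒 u , tp^-ℙᵉˣᵖ u) , All.[]
    common (f List.∷ fs) =
      let (B , (B∈𝓒 , B∈u) , B⊆) = common fs
          (A∈𝓒 , A∈u) = family-member f
      in family f ∩ B ,
         (∩-𝓒 {family f} {B} u A∈𝓒 B∈𝓒 A∈u B∈u , tp^-∩ {family f} {B} u A∈u B∈u) ,
         proj₁ All.∷ All.map {P = λ g → B ⊆ family g} (λ {g} B⊆A {c} h → B⊆A {c} (proj₂ h)) B⊆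

    -- For each code `f`, the powers in `family f` that exactly divide `y` form an internal set.
    -- Saturation yields one `c` in all of them, and `convex-≈ᴮ` recognises its class.
    realise : ∀ y → (∀ A → ConvexMember A → AtLeast 1 (DivisorsIn A y)) → ∃[ v ] (v ≈ᴮ u × v ∥ y)
    realise y h = v , convex-≈ᴮ u v members , from (∥⇔Part⋆ {v}) (c , proj₁ (proj₂ (proj₂ (at-f f₀))) ,
                        proj₂ (proj₂ (proj₂ (proj₂ (proj₂ (at-f f₀))))))
      where
      sections : ∀ f → _
      sections f = section-internal (PartIn (family f)) y
      D : (ℕ → Bool) → V ⋆ℕ
      D f = proj₁ (sections f)
      finite-intersection : ∀ fs → ∃[ w ] All (λ f → w ∈ⱽ D f) fs
      finite-intersection fs =
        let (B , B∈ , B⊆) = common fs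
            (w , B∈w , w∥y) = proj₁ (h B B∈) zero
            (c , t , part) = to (∥⇔Part⋆ {w}) w∥y
            c∈B = to (tp^⇔∈⋆ B (to I⋆₃-sound (proj₁ part))) B∈w
        in atom c , All.map {P = λ f → B ⊆ family f} (λ {f} B⊆A →
             from (proj₂ (proj₂ (proj₂ (sections f))) c)
             (from (partIn⋆ (family f)) (base w , exponent w , t , base-prime w ,
               ∈⋆-mono {B} {family f} {c} B⊆A c∈B , part))) B⊆
      realised : ∃[ w ] (∀ f → w ∈ⱽ D f)
      realised = saturated D (λ f → proj₁ (proj₂ (sections f))) finite-intersection
      -- Any index would do: the prime and the exponent are read off once, and membership in the
      -- other sets concerns only the power `c`.
      f₀ : ℕ → Bool
      f₀ _ = true
      w-atom : ∃[ c ] proj₁ realised ≈ⱽ atom c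
      w-atom = proj₁ (proj₂ (proj₂ (sections f₀))) (proj₁ realised) (proj₂ realised f₀)
      c = proj₁ w-atom
      at-f : ∀ f → ∃[ p ] ∃[ a ] ∃[ t ] (p ∈⋆ Prime⁺ × c ∈⋆ family f × Part⋆ p a c t y)
      at-f f = to (partIn⋆ (family f)) (to (proj₂ (proj₂ (proj₂ (sections f))) c)
        (∈ⱽ-respˡ {v = proj₁ realised} {atom c} {D f} (proj₂ w-atom) (proj₂ realised f)))
      v : BasicClass
      v = record { base = proj₁ (at-f f₀) ; exponent = proj₁ (proj₂ (at-f f₀))
                 ; base-prime = proj₁ (proj₂ (proj₂ (proj₂ (at-f f₀)))) }
      p^a≡c : IsPower (base v) (exponent v) c
      p^a≡c = to I⋆₃-sound (proj₁ (proj₂ (proj₂ (proj₂ (proj₂ (proj₂ (at-f f₀)))))))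
      members : ∀ A → A ∈ 𝓒 → A ∈ tp^ᴮ u → A ∈ tp^ᴮ v
      members A A∈𝓒 A∈u = c , p^a≡c ,
        -- At the code of a convex member the default does not apply, so `family f` is contained in
        -- `A`.
        ∈⋆-mono {family f} {A} {c} (λ k → proj₁ (code-encode A) (select-⊆ (code f) lem coded k))
          (proj₁ (proj₂ (proj₂ (proj₂ (proj₂ (at-f f))))))
        where
        f = encode A
        coded : ConvexMember (code f)
        coded = 𝓒-resp-≐ {A} {code f} (proj₂ (code-encode A) , proj₁ (code-encode A)) A∈𝓒 ,
                tp^-mono {A} {code f} u (proj₂ (code-encode A)) A∈u

  -- Patterns and their sums as numbers of divisors.

  module _ (z : ⋆ℕ) (z∞ : Infinite z) where
    open Cardinality z

    numeral : ∀ {n} → Fin n → ℕ⁺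
    numeral i = pos (suc (toℕ i))

    numeral-injective : ∀ {n} (i j : Fin n) → ι (numeral i) ≡ ι (numeral j) → i ≡ j
    numeral-injective i j e = toℕ-injective (ℕ.suc-injective (cong value (ι-injective e)))

    -- For ∞, an infinite `z` lies above every numeral; for finite `m`, the pigeonhole principle
    -- bounds `n`.
    segment : ∀ k n → [ n ] ≤⁺ k ⇔ AtLeast n (On.setoid {B = ∃ (Segment k)} (setoid ⋆ℕ) proj₁)
    segment ∞ n = mk⇔
      (λ _ → (λ i → ι (numeral i) , ≤-infinite z∞ (numeral i)) , numeral-injective)
      (λ _ → _ ≤⊤⁺)
    segment [ m ] n = mk⇔
      (λ { [ n≤m ] → (λ i → ι (numeral i) , numeral i , ℕ.≤-trans (toℕ<n i) n≤m , refl) , numeral-injective })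
      (λ (f , f-inj) → [ injective⇒≤ {f = index f} (λ {i} {j} e → f-inj i j (index-injective f i j e)) ])
      where
      index : (f : Fin n → ∃ (Segment [ m ])) → Fin n → Fin m
      index f i with f i
      ... | _ , pos (suc k) , k<m , _ = fromℕ< k<m
      index-injective : ∀ f i j → index f i ≡ index f j → proj₁ (f i) ≡ proj₁ (f j)
      index-injective f i j e with f i | f j
      ... | _ , pos (suc k) , k<m , refl | _ , pos (suc l) , l<m , refl =
        cong ι (ℕ⁺-≡ (cong suc (fromℕ<-injective k l k<m l<m e)))

    card-≥ : ∀ {a ℓ} {S : Setoid a ℓ} {k} → HasCard S k → ∀ n → [ n ] ≤⁺ k ⇔ AtLeast n S
    card-≥ {k = k} β n = segment k n ⨟ AtLeast-bijection β n

    exactDivisors-resp : ∀ x {v w} → v ≈ᴮ w → ∀ n →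
                         AtLeast n (exactDivisors x v) → AtLeast n (exactDivisors x w)
    exactDivisors-resp x {v} {w} v≈w n (f , f-inj) =
      (λ i → proj₁ (f i) , Setoid.trans 𝓑 {proj₁ (f i)} {v} {w} (proj₁ (proj₂ (f i))) v≈w ,
             proj₂ (proj₂ (f i))) , f-inj

    -- A pattern is given as a function on representatives, so its invariance is derived: equivalent
    -- representatives have the same exact divisors.
    pattern-resp : ∀ {x α} → IsPattern x α → ∀ {v w} → v ≈ᴮ w → α v ≡ α w
    pattern-resp {x} {α} pat {v} {w} v≈w =
      ≤⁺-antisym-≡ ℕ.≤-antisym (≤⁺-from-below (α v) (α w) (one-side v≈w))
                 (≤⁺-from-below (α w) (α v) (one-side (Setoid.sym 𝓑 {v} {w} v≈w)))
      where
      one-side : ∀ {v w} → v ≈ᴮ w → ∀ n → [ n ] ≤⁺ α v → [ n ] ≤⁺ α w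
      one-side {v} {w} v≈w n h =
        from (card-≥ (pat w) n) (exactDivisors-resp x {v} {w} v≈w n (to (card-≥ (pat v) n) h))

    -- The bijections of the pattern turn points of the segment of length `α v` into exact divisors
    -- of class `v`, and back. Convexity enters in `backward`: one divisor in `A` puts its whole
    -- class into `A̅`.
    sum-≥ : ∀ {x α A} → IsPattern x α → A ∈ 𝓒 → ∀ n →
            AtLeast n (disjointUnion α A) ⇔ AtLeast n (DivisorsIn A x)
    sum-≥ {x} {α} {A} pat A∈𝓒 n = mk⇔ forward backward
      where
      module β w = Bijection (pat w)
      forward : AtLeast n (disjointUnion α A) → AtLeast n (DivisorsIn A x)
      forward (f , f-inj) = g , g-inj
        where
        v : Fin n → BasicClass
        v i = proj₁ (f i)
        a : Fin n → ⋆ℕ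
        a i = proj₁ (proj₂ (proj₂ (f i)))
        reps = representatives 𝓑 v
        r = proj₁ reps
        seg : ∀ i → Segment (α (v (r i))) (a i)
        seg i = subst (λ k → Segment k (a i))
          (sym (pattern-resp pat {v (r i)} {v i} (proj₁ (proj₂ reps) i))) (proj₂ (proj₂ (proj₂ (f i))))
        image : ∀ i → ∃ (ExactDivisor x (v (r i)))
        image i = β.to (v (r i)) (a i , seg i)
        g : Fin n → Setoid.Carrier (DivisorsIn A x)
        g i = let (w , w≈v , w∥x) = image i in
              w , proj₁ (proj₂ (f (r i))) w w≈v , w∥x
        -- `r i` and `r j` are not variables, so their equality can be matched only after
        -- generalising to `k` and `l`.
        fibre-injective : ∀ k l {b c} (s : Segment (α (v k)) b) (t : Segment (α (v l)) c) → k ≡ l →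
          pair (proj₁ (β.to (v k) (b , s))) ≡ pair (proj₁ (β.to (v l) (c , t))) → b ≡ c
        fibre-injective k .k s t refl e = β.injective (v k) {_ , s} {_ , t} e
        g-inj : ∀ i j → pair (proj₁ (g i)) ≡ pair (proj₁ (g j)) → i ≡ j
        g-inj i j e = f-inj i j (vᵢ≈vⱼ , fibre-injective (r i) (r j) (seg i) (seg j)
                                           (proj₂ (proj₂ reps) i j vᵢ≈vⱼ) e)
          where
          wᵢ = proj₁ (image i)
          wⱼ = proj₁ (image j)
          chain : ∀ {s t w} → s ≈ᴮ t → t ≈ᴮ w → s ≈ᴮ w
          chain {s} {t} {w} = Setoid.trans 𝓑 {s} {t} {w}
          back : ∀ {s t} → s ≈ᴮ t → t ≈ᴮ s
          back {s} {t} = Setoid.sym 𝓑 {s} {t}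
          vᵢ≈vⱼ : v i ≈ᴮ v j
          vᵢ≈vⱼ = chain {v i} {v (r i)} {v j} (back {v (r i)} {v i} (proj₁ (proj₂ reps) i))
            (chain {v (r i)} {wᵢ} {v j} (back {wᵢ} {v (r i)} (proj₁ (proj₂ (image i))))
            (chain {wᵢ} {wⱼ} {v j} (pair-≈ᴮ {wᵢ} {wⱼ} e)
            (chain {wⱼ} {v (r j)} {v j} (proj₁ (proj₂ (image j))) (proj₁ (proj₂ reps) j))))
      backward : AtLeast n (DivisorsIn A x) → AtLeast n (disjointUnion α A)
      backward (g , g-inj) = f , f-inj
        where
        w : Fin n → BasicClass
        w i = proj₁ (g i)
        reps = representatives 𝓑 w
        r = proj₁ reps
        preimage : ∀ i k → w i ≈ᴮ w k → _
        preimage i k wᵢ≈wₖ = β.strictlySurjective (w k) (w i , wᵢ≈wₖ , proj₂ (proj₂ (g i)))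
        to-rep : ∀ i → w i ≈ᴮ w (r i)
        to-rep i = Setoid.sym 𝓑 {w (r i)} {w i} (proj₁ (proj₂ reps) i)
        f : Fin n → Setoid.Carrier (disjointUnion α A)
        f i = w (r i) , convex-∈ᴮ {A} (w (r i)) A∈𝓒 (proj₁ (proj₂ (g (r i)))) ,
              proj₁ (preimage i (r i) (to-rep i))
        fibre : ∀ i j k l (e : w i ≈ᴮ w k) (e′ : w j ≈ᴮ w l) → k ≡ l →
                proj₁ (proj₁ (preimage i k e)) ≡ proj₁ (proj₁ (preimage j l e′)) →
                pair (w i) ≡ pair (w j)
        fibre i j k .k e e′ refl a≡b =
          trans (sym (proj₂ (preimage i k e)))
            (trans (β.cong (w k) {proj₁ (preimage i k e)} {proj₁ (preimage j k e′)} a≡b)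
              (proj₂ (preimage j k e′)))
        f-inj : ∀ i j → Setoid._≈_ (disjointUnion α A) (f i) (f j) → i ≡ j
        f-inj i j (rᵢ≈rⱼ , a≡b) = g-inj i j (fibre i j (r i) (r j) (to-rep i) (to-rep j)
          (proj₂ (proj₂ reps) i j wᵢ≈wⱼ) a≡b)
          where
          wᵢ≈wⱼ : w i ≈ᴮ w j
          wᵢ≈wⱼ = Setoid.trans 𝓑 {w i} {w (r i)} {w j} (to-rep i)
            (Setoid.trans 𝓑 {w (r i)} {w (r j)} {w j} rᵢ≈rⱼ (proj₁ (proj₂ reps) j))

-- Limits of the sums and their minimum over convex sets.

theorem3p7 : (∀ {ℓ} → ExcludedMiddle ℓ) →
    (E : NonstandardExtension) →
    let open NonstandardExtension E
        open Extension E in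
    𝔠⁺-Saturated →
    IsomorphismProperty →
    (z : ⋆ℕ) → Infinite z →
    let open Cardinality z in
    ∀ {i} {I : Set i} (G : I → Ultrafilter ℕ⁺) (H : Ultrafilter I) →
    (αF : BasicClass → ℕ∞) → IsPatternᵁ (lim H G) αF →
    (αG : I → BasicClass → ℕ∞) → (∀ j → IsPatternᵁ (G j) (αG j)) →
    (S : I → Pred ℕ⁺ 0ℓ → ℕ∞) → (∀ j A → A ∈ 𝓒 → IsSum (αG j) A (S j A)) →
    (u : BasicClass) →
    ∃[ L ] ((∀ A → A ∈ 𝓒 → HLim H (λ j → S j A) (L A)) ×
            IsMinimum (λ A → A ∈ᴮ u × A ∈ 𝓒) L (αF u))
theorem3p7 lem E saturated _ z z∞ {I = I} G H αF (x , x⊨F , αF-pattern) αG αG-pattern S S-sum u =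
  L , (λ A _ → proj₁ (proj₂ (limit-exists H (λ j → S j A)))) ,
  attained (αF u) refl , λ A (A∈u , A∈𝓒) → αF≤L A A∈u A∈𝓒
  where
  open NonstandardExtension E
  open Extension E
  open Cardinality z
  open Star lem E
  open Classical lem
  open Patterns lem E
  module H = Ultrafilter H

  L : Pred ℕ⁺ 0ℓ → ℕ∞
  L A = proj₁ (limit-exists H (λ j → S j A))

  -- The generator of `G j` disappears from the right-hand side, which has the same form for all `j`
  -- and so passes to the limit.
  S-≥ : ∀ j A → A ∈ 𝓒 → ∀ n → [ n ] ≤⁺ S j A ⇔ Divisors≥ n A ∈ member (G j)
  S-≥ j A A∈𝓒 n =
    let (y , (y⊆G , G⊆y) , pattern′) = αG-pattern j in
    card-≥ z z∞ (S-sum j A A∈𝓒) n ⨟ sum-≥ z z∞ {y} {αG j} {A} pattern′ A∈𝓒 n ⨟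
    divisors≥ n A y ⨟ mk⇔ (y⊆G {Divisors≥ n A}) (G⊆y {Divisors≥ n A})

  -- By definition of `lim`, `Divisors≥ n A` lies in `G j` for ℋ-almost all `j` exactly when it lies
  -- in ℱ, whose generator is `x`.
  L-≥ : ∀ A → A ∈ 𝓒 → ∀ n → [ n ] ≤⁺ L A ⇔ AtLeast n (DivisorsIn A x)
  L-≥ A A∈𝓒 n =
    proj₂ (proj₂ (limit-exists H (λ j → S j A))) n ⨟
    mk⇔ (H.upward (λ {j} → to (S-≥ j A A∈𝓒 n))) (H.upward (λ {j} → from (S-≥ j A A∈𝓒 n))) ⨟
    mk⇔ (proj₂ x⊨F {Divisors≥ n A}) (proj₁ x⊨F {Divisors≥ n A}) ⨟
    mk⇔ (from (divisors≥ n A x)) (to (divisors≥ n A x))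

  αF≤L : ∀ A → A ∈ᴮ u → A ∈ 𝓒 → αF u ≤⁺ L A
  αF≤L A A∈u A∈𝓒 = ≤⁺-from-below (αF u) (L A) λ n h →
    let (f , f-inj) = to (card-≥ z z∞ (αF-pattern u) n) h in
    from (L-≥ A A∈𝓒 n)
      ((λ i → proj₁ (f i) , A∈u (proj₁ (f i)) (proj₁ (proj₂ (f i))) , proj₂ (proj₂ (f i))) , f-inj)

  u-∈ᴮ : ∀ A → A ∈ 𝓒 → A ∈ tp^ᴮ u → A ∈ᴮ u
  u-∈ᴮ A = convex-∈ᴮ {A} u

  attained : ∀ k → αF u ≡ k → ∃[ A ] ((A ∈ᴮ u × A ∈ 𝓒) × L A ≡ αF u)
  -- The lower bound is already ∞, so any convex member attains it; `ℙᵉˣᵖ` is always one.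
  attained ∞ αFu≡∞ = ℙᵉˣᵖ , (ℙ∈u , ℙᵉˣᵖ-𝓒 u) ,
    ≤⁺-antisym-≡ ℕ.≤-antisym (subst (L ℙᵉˣᵖ ≤⁺_) (sym αFu≡∞) (_ ≤⊤⁺)) (αF≤L ℙᵉˣᵖ ℙ∈u (ℙᵉˣᵖ-𝓒 u))
    where
    ℙ∈u : ℙᵉˣᵖ ∈ᴮ u
    ℙ∈u = u-∈ᴮ ℙᵉˣᵖ (ℙᵉˣᵖ-𝓒 u) (tp^-ℙᵉˣᵖ u)
  attained [ n ] αFu≡n = decidable-stable lem λ not-attained →
    let (f , f-inj) = to (card-≥ z z∞ (αF-pattern u) n) (subst ([ n ] ≤⁺_) (sym αFu≡n) [ ℕ.≤-refl ])
        d = proj₁ ∘ f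
        (y , other , many) = divide-out n x d f-inj (λ i → proj₂ (proj₂ (f i)))
        -- `n + 1` has the shape `n + m` of `divide-out` with `m = 1`: after `n` divisors of class
        -- `u` are divided out, at least one divisor in `A` remains.
        exceeds : ∀ A → A ∈ 𝓒 → A ∈ tp^ᴮ u → [ n ℕ.+ 1 ] ≤⁺ L A
        exceeds A A∈𝓒 A∈u = subst (λ m → [ m ] ≤⁺ L A) (ℕ.+-comm 1 n)
          (≤⁺-≢⇒suc≤⁺ (subst (_≤⁺ L A) αFu≡n (αF≤L A (u-∈ᴮ A A∈𝓒 A∈u) A∈𝓒))
            (λ LA≡n → not-attained (A , (u-∈ᴮ A A∈𝓒 A∈u , A∈𝓒) , trans LA≡n (sym αFu≡n))))
        (v , v≈u , v∥y) = Saturated.realise saturated u y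
          (λ A (A∈𝓒 , A∈u) → many A 1 (to (L-≥ A A∈𝓒 (n ℕ.+ 1)) (exceeds A A∈𝓒 A∈u)))
        (v∥x , v≢d) = other v v∥y
        extended = extend n f f-inj (v , v≈u , v∥x) v≢d
    in absurd (subst ([ suc n ] ≤⁺_) αFu≡n (from (card-≥ z z∞ (αF-pattern u) (suc n)) extended))
    where
    absurd : ¬ [ suc n ] ≤⁺ [ n ]
    absurd [ n<n ] = ℕ.1+n≰n n<n
    extend : ∀ n (f : Fin n → ∃ (ExactDivisor x u)) →
      (∀ i j → pair (proj₁ (f i)) ≡ pair (proj₁ (f j)) → i ≡ j) →
      (w : ∃ (ExactDivisor x u)) → (∀ i → ¬ pair (proj₁ w) ≡ pair (proj₁ (f i))) →
      AtLeast (suc n) (exactDivisors x u)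
    extend n f f-inj w w≢f = g , g-inj
      where
      g : Fin (suc n) → ∃ (ExactDivisor x u)
      g zero    = w
      g (suc i) = f i
      g-inj : ∀ i j → pair (proj₁ (g i)) ≡ pair (proj₁ (g j)) → i ≡ j
      g-inj zero    zero    _ = refl
      g-inj zero    (suc j) e = contradiction e (w≢f j)
      g-inj (suc i) zero    e = contradiction (sym e) (w≢f i)
      g-inj (suc i) (suc j) e = cong suc (f-inj i j e)
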